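{- Let $G$ be a non-empty finite simple graph without isolated vertices. If $G$ is a star forest or $G=P_4$, then $\chi^+(G)=2$. If $G=K_3$, then $\chi^+(G)=3$. For all other such $G$, $\chi^+(G)=\infty$.
   Context: An edge-ordering (labeling) $L$ of a simple graph $G$ is a linear order on its edges, giving the edge-ordered graph $G^L$; isomorphisms of edge-ordered graphs preserve order, subgraphs carry the induced order. A simple graph can avoid an edge-ordered graph $H$ if some edge-ordering of it has no subgraph isomorphic to $H$. The order chromatic number $\chi'_<(H)$ is the least chromatic number of a finite simple graph that cannot avoid $H$ ($\infty$ if none). $\chi^+(G)=\max_L \chi'_<(G^L)$ over all edge-orderings $L$ of $G$. A star forest is a non-empty graph all of whose components are stars; $P_4$ is the path on four vertices. -}

module Defs where

open import Data.Nat using (ℕ; zero; suc; _≤_; _<_; _∸_)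
open import Data.Fin using (Fin) renaming (zero to f0; suc to fs)
open import Data.Bool using (Bool; true; false)
open import Data.Product using (Σ; ∃; _×_; _,_)
open import Data.Sum using (_⊎_)
open import Relation.Binary.PropositionalEquality using (_≡_; _≢_)
open import Relation.Nullary using (¬_)

record Graph : Set where
  field
    n      : ℕ
    adj    : Fin n → Fin n → Bool
    sym    : ∀ i j → adj i j ≡ adj j i
    irrefl : ∀ i → adj i i ≡ false
open Graph public

Adj : (G : Graph) → Fin (n G) → Fin (n G) → Set
Adj G i j = adj G i j ≡ true

NonEmpty : Graph → Set
NonEmpty G = 1 ≤ n G

NoIsolatedVertices : Graph → Set
NoIsolatedVertices G = ∀ v → ∃ λ u → Adj G v u

record Iso (G H : Graph) : Set where
  field
    to    : Fin (n G) → Fin (n H)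
    from  : Fin (n H) → Fin (n G)
    from-to : ∀ v → from (to v) ≡ v
    to-from : ∀ w → to (from w) ≡ w
    adj-pres : ∀ u v → adj H (to u) (to v) ≡ adj G u v

data Reach (G : Graph) : Fin (n G) → Fin (n G) → Set where
  here : ∀ {v} → Reach G v v
  step : ∀ {u v w} → Adj G u v → Reach G v w → Reach G u w

ComponentIsStar : (G : Graph) → Fin (n G) → Set
ComponentIsStar G v =
  ∃ λ c → Reach G v c
    × (∀ u w → Reach G v u → Reach G v w → Adj G u w → (u ≡ c ⊎ w ≡ c))
    × (∀ u → Reach G v u → u ≢ c → Adj G c u)

IsStarForest : Graph → Set
IsStarForest G = NonEmpty G × (∀ v → ComponentIsStar G v)

p4adj : Fin 4 → Fin 4 → Bool
p4adj f0 (fs f0) = true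
p4adj (fs f0) f0 = true
p4adj (fs f0) (fs (fs f0)) = true
p4adj (fs (fs f0)) (fs f0) = true
p4adj (fs (fs f0)) (fs (fs (fs f0))) = true
p4adj (fs (fs (fs f0))) (fs (fs f0)) = true
p4adj _ _ = false

p4sym : ∀ i j → p4adj i j ≡ p4adj j i
p4sym f0 f0 = _≡_.refl
p4sym f0 (fs f0) = _≡_.refl
p4sym f0 (fs (fs f0)) = _≡_.refl
p4sym f0 (fs (fs (fs f0))) = _≡_.refl
p4sym (fs f0) f0 = _≡_.refl
p4sym (fs f0) (fs f0) = _≡_.refl
p4sym (fs f0) (fs (fs f0)) = _≡_.refl
p4sym (fs f0) (fs (fs (fs f0))) = _≡_.refl
p4sym (fs (fs f0)) f0 = _≡_.refl
p4sym (fs (fs f0)) (fs f0) = _≡_.refl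
p4sym (fs (fs f0)) (fs (fs f0)) = _≡_.refl
p4sym (fs (fs f0)) (fs (fs (fs f0))) = _≡_.refl
p4sym (fs (fs (fs f0))) f0 = _≡_.refl
p4sym (fs (fs (fs f0))) (fs f0) = _≡_.refl
p4sym (fs (fs (fs f0))) (fs (fs f0)) = _≡_.refl
p4sym (fs (fs (fs f0))) (fs (fs (fs f0))) = _≡_.refl

p4irr : ∀ i → p4adj i i ≡ false
p4irr f0 = _≡_.refl
p4irr (fs f0) = _≡_.refl
p4irr (fs (fs f0)) = _≡_.refl
p4irr (fs (fs (fs f0))) = _≡_.refl

P4 : Graph
P4 = record { n = 4 ; adj = p4adj ; sym = p4sym ; irrefl = p4irr }

k3adj : Fin 3 → Fin 3 → Bool
k3adj f0 f0 = false
k3adj (fs f0) (fs f0) = false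
k3adj (fs (fs f0)) (fs (fs f0)) = false
k3adj _ _ = true

k3sym : ∀ i j → k3adj i j ≡ k3adj j i
k3sym f0 f0 = _≡_.refl
k3sym f0 (fs f0) = _≡_.refl
k3sym f0 (fs (fs f0)) = _≡_.refl
k3sym (fs f0) f0 = _≡_.refl
k3sym (fs f0) (fs f0) = _≡_.refl
k3sym (fs f0) (fs (fs f0)) = _≡_.refl
k3sym (fs (fs f0)) f0 = _≡_.refl
k3sym (fs (fs f0)) (fs f0) = _≡_.refl
k3sym (fs (fs f0)) (fs (fs f0)) = _≡_.refl

k3irr : ∀ i → k3adj i i ≡ false
k3irr f0 = _≡_.refl
k3irr (fs f0) = _≡_.refl
k3irr (fs (fs f0)) = _≡_.refl

K3 : Graph
K3 = record { n = 3 ; adj = k3adj ; sym = k3sym ; irrefl = k3irr }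

Colourable : Graph → ℕ → Set
Colourable G k = Σ (Fin (n G) → Fin k) λ c → ∀ u v → Adj G u v → c u ≢ c v

ChromaticNumber : Graph → ℕ → Set
ChromaticNumber G k = Colourable G k × (∀ j → Colourable G j → k ≤ j)

-- Edge-orderings.  A linear order on E(G) is represented by a rank
-- function on vertex pairs, symmetric, and injective on edges
-- (the order is  e < e'  iff  rank e < rank e').

record EdgeOrdering (G : Graph) : Set where
  field
    rank     : Fin (n G) → Fin (n G) → ℕ
    rank-sym : ∀ i j → rank i j ≡ rank j i
    rank-inj : ∀ i j k l → Adj G i j → Adj G k l → rank i j ≡ rank k l →
               (i ≡ k × j ≡ l) ⊎ (i ≡ l × j ≡ k)
open EdgeOrdering public

record OGraph : Set where
  field
    graph : Graph
    order : EdgeOrdering graph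
open OGraph public

Contains : (G : Graph) → EdgeOrdering G → OGraph → Set
Contains G L H =
  Σ (Fin (n (graph H)) → Fin (n G)) λ f →
      (∀ x y → f x ≡ f y → x ≡ y)
    × (∀ x y → Adj (graph H) x y → Adj G (f x) (f y))
    × (∀ x y x' y' → Adj (graph H) x y → Adj (graph H) x' y' →
         (rank (order H) x y < rank (order H) x' y'
            → rank L (f x) (f y) < rank L (f x') (f y'))
       × (rank L (f x) (f y) < rank L (f x') (f y')
            → rank (order H) x y < rank (order H) x' y'))

CanAvoid : Graph → OGraph → Set
CanAvoid G H = ∃ λ (L : EdgeOrdering G) → ¬ Contains G L H

data ℕ∞ : Set where
  fin : ℕ → ℕ∞
  ∞   : ℕ∞

data _≤∞_ : ℕ∞ → ℕ∞ → Set where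
  fin≤fin : ∀ {m k} → m ≤ k → fin m ≤∞ fin k
  _≤∞∞    : ∀ x → x ≤∞ ∞

OrderChromaticNumber : OGraph → ℕ∞ → Set
OrderChromaticNumber H (fin m) =
    (∃ λ G → ChromaticNumber G m × ¬ CanAvoid G H)
  × (∀ G k → ChromaticNumber G k → ¬ CanAvoid G H → m ≤ k)
OrderChromaticNumber H ∞ = ∀ G → CanAvoid G H

ChiPlus : Graph → ℕ∞ → Set
ChiPlus G v =
    (∃ λ (L : EdgeOrdering G) →
       OrderChromaticNumber (record { graph = G ; order = L }) v)
  × (∀ (L : EdgeOrdering G) w →
       OrderChromaticNumber (record { graph = G ; order = L }) w → w ≤∞ v)

{-# OPTIONS --safe #-}

-- Unavoidability in bipartite graphs.  By Ramsey's theorem for pairs, applied to the rows and then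
-- to the columns, every edge-ordering of a large enough K_{X,Y} contains vertices a_1, ..., a_T on
-- one side and b_1, ..., b_T on the other such that for i < j every edge at a_i precedes every edge
-- at a_j.  An ordered star forest is found there with its centres among the b's and the edge
-- of rank k ending in the leaf a_k, and each of the six orderings of P4 already occurs for T = 2.
--
-- Avoidability.  Order the edges of a graph lexicographically by (minimum, maximum).  In a copy of H
-- the edges at the smallest vertex then precede all other edges of the copy.  If uv is an edge of G
-- whose ends both have degree at least 2, one prescribes the first two or three edges of an ordering
-- of G so that no vertex has this property, unless G is P4 or K3.  A graph without isolated vertices
-- and without such an edge uv is a star forest.
module Submission where

open import Defs
open import Data.Bool using (Bool; true; false; T; _xor_)
import Data.Bool.Properties as Bool
open import Data.Fin as Fin using (Fin; toℕ; fromℕ; fromℕ<; inject₁; opposite; combine; remQuot; splitAt; _↑ˡ_; _↑ʳ_) renaming (zero to f0; suc to fs)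
open import Data.Fin.Properties as Fin using (all?; any?)
open import Data.List using (List; []; _∷_; length; filter; lookup; allFin)
open import Data.List.Extrema.Nat using (argmin; f[argmin]≤f[xs])
open import Data.List.Membership.Propositional.Properties using (∈-lookup; ∈-allFin)
open import Data.List.Properties using (length-tabulate)
open import Data.List.Relation.Binary.Sublist.Propositional using (_⊆_; []; _∷_; _∷ʳ_; ⊆-trans; minimum)
open import Data.List.Relation.Binary.Sublist.Propositional.Properties using (All-resp-⊆; filter-⊆)
open import Data.List.Relation.Unary.All as All using ([]; _∷_)
open import Data.List.Relation.Unary.All.Properties using (all-filter)
open import Data.List.Relation.Unary.AllPairs using (AllPairs; []; _∷_)
open import Data.List.Relation.Unary.AllPairs.Properties using (tabulate⁺-<)
open import Data.Nat using (ℕ; zero; suc; _+_; _*_; _⊔_; _≤_; _<_; _≤?_; _<ᵇ_; z≤n; s≤s)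
open import Data.Nat.Properties as ℕ using ()
open import Data.Product using (∃; _×_; _,_; proj₁; proj₂)
open import Data.Sum using (_⊎_; inj₁; inj₂; [_,_])
open import Data.Unit using (tt)
open import Data.Vec as Vec using (Vec; []; _∷_)
open import Function using (_∘_; id; flip)
open import Relation.Binary.Definitions using (tri<; tri≈; tri>)
open import Relation.Binary.PropositionalEquality using (_≡_; _≢_; refl; trans; cong; cong₂; subst; subst₂) renaming (sym to ≡-sym)
open import Relation.Nullary using (¬_; Dec; yes; no; contradiction; ¬?; _×-dec_; _⊎-dec_; _→-dec_)
open import Relation.Nullary.Decidable using (from-yes; decidable-stable)

-- Ramsey's theorem and block structure of matrices

private variable
  A : Set

-- The colouring is read only on pairs in list order, so an asymmetric comparison can serve as `f`.
Mono : (A → A → Bool) → Bool → ℕ → List A → Set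
Mono f c k xs = ∃ λ ys → ys ⊆ xs × length ys ≡ k × AllPairs (λ x y → f x y ≡ c) ys

Mono-mono-⊆ : ∀ {f : A → A → Bool} {c k xs zs} → xs ⊆ zs → Mono f c k xs → Mono f c k zs
Mono-mono-⊆ xs⊆zs (ys , ys⊆xs , len , pairs) = ys , ⊆-trans ys⊆xs xs⊆zs , len , pairs

select : (A → Bool) → Bool → List A → List A
select f c = filter (λ x → f x Bool.≟ c)

length-select : ∀ (f : A → Bool) xs →
                length (select f true xs) + length (select f false xs) ≡ length xs
length-select f []       = refl
length-select f (x ∷ xs) with f x
... | true  = cong suc (length-select f xs)
... | false = trans (ℕ.+-suc _ _) (cong suc (length-select f xs))

Mono-cons : ∀ {f : A → A → Bool} {c k} x xs →
            Mono f c k (select (f x) c xs) → Mono f c (suc k) (x ∷ xs)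
Mono-cons {f = f} {c} x xs (ys , ys⊆ , len , pairs) =
  x ∷ ys , refl ∷ ⊆-trans ys⊆ (filter-⊆ _ xs) , cong suc len ,
  All-resp-⊆ ys⊆ (all-filter (λ y → f x y Bool.≟ c) xs) ∷ pairs

-- The Erdős-Szekeres recursion with one extra point: beside the pivot, the two colour classes
-- together have at least the sum of both bounds, so one class reaches its own.
ramseyBound : ℕ → ℕ → ℕ
ramseyBound zero    _       = 0
ramseyBound (suc m) zero    = 0
ramseyBound (suc m) (suc n) = suc (ramseyBound m (suc n) + ramseyBound (suc m) n)

m+n≤o+p⇒m≤o⊎n≤p : ∀ m n {o p} → m + n ≤ o + p → m ≤ o ⊎ n ≤ p
m+n≤o+p⇒m≤o⊎n≤p m n {o} {p} le with ℕ.≤-<-connex m o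
... | inj₁ m≤o = inj₁ m≤o
... | inj₂ o<m with ℕ.≤-<-connex n p
...   | inj₁ n≤p = inj₂ n≤p
...   | inj₂ p<n = contradiction le (ℕ.<⇒≱ (ℕ.+-mono-< o<m p<n))

-- The head serves as pivot. In a colour class that reaches its bound, a sublist of the pivot's
-- colour is one short and is extended by the pivot; a sublist of the other colour already has full
-- length.
ramsey-list : ∀ (f : A → A → Bool) m n xs → ramseyBound m n ≤ length xs →
              Mono f true m xs ⊎ Mono f false n xs
ramsey-list f zero    n    xs _ = inj₁ ([] , minimum _ , refl , [])
ramsey-list f (suc m) zero xs _ = inj₂ ([] , minimum _ , refl , [])
ramsey-list f (suc m) (suc n) (x ∷ xs) (s≤s le)
  with m+n≤o+p⇒m≤o⊎n≤p (ramseyBound m (suc n)) _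
         (ℕ.≤-trans le (ℕ.≤-reflexive (≡-sym (length-select (f x) xs))))
... | inj₁ leᵗ with ramsey-list f m (suc n) (select (f x) true xs) leᵗ
...   | inj₁ mono = inj₁ (Mono-cons x xs mono)
...   | inj₂ mono = inj₂ (Mono-mono-⊆ (x ∷ʳ filter-⊆ _ xs) mono)
ramsey-list f (suc m) (suc n) (x ∷ xs) (s≤s le)
    | inj₂ leᶠ with ramsey-list f (suc m) n (select (f x) false xs) leᶠ
...   | inj₁ mono = inj₁ (Mono-mono-⊆ (x ∷ʳ filter-⊆ _ xs) mono)
...   | inj₂ mono = inj₂ (Mono-cons x xs mono)

AllPairs-resp-⊆ : ∀ {R : A → A → Set} {xs ys} → xs ⊆ ys → AllPairs R ys → AllPairs R xs
AllPairs-resp-⊆ []            []         = []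
AllPairs-resp-⊆ (_ ∷ʳ τ)      (_  ∷ rys) = AllPairs-resp-⊆ τ rys
AllPairs-resp-⊆ (refl ∷ τ)    (ry ∷ rys) = All-resp-⊆ τ ry ∷ AllPairs-resp-⊆ τ rys

AllPairs-lookup : ∀ {R : A → A → Set} {xs} → AllPairs R xs →
                  ∀ {i j} → i Fin.< j → R (lookup xs i) (lookup xs j)
AllPairs-lookup (r ∷ rs) {f0}   {fs j} _         = All.lookup r (∈-lookup j)
AllPairs-lookup (r ∷ rs) {fs i} {fs j} (s≤s i<j) = AllPairs-lookup rs i<j

Increasing : ∀ {m n} → (Fin m → Fin n) → Set
Increasing g = ∀ {i j} → i Fin.< j → g i Fin.< g j

Increasing⇒injective : ∀ {m n} {g : Fin m → Fin n} → Increasing g → ∀ i j → g i ≡ g j → i ≡ j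
Increasing⇒injective inc i j eq with Fin.<-cmp i j
... | tri< i<j _ _ = contradiction eq (Fin.<⇒≢ (inc i<j))
... | tri≈ _ i≡j _ = i≡j
... | tri> _ _ j<i = contradiction (≡-sym eq) (Fin.<⇒≢ (inc j<i))

Homogeneous : ∀ {k N} → (Fin k → Fin N) → (Fin N → Fin N → Bool) → Set
Homogeneous g f = ∃ λ c → ∀ {i j} → i Fin.< j → f (g i) (g j) ≡ c

Mono⇒Homogeneous : ∀ {N} {f : Fin N → Fin N → Bool} {c k} → Mono f c k (allFin N) →
                   ∃ λ (g : Fin k → Fin N) → Increasing g × Homogeneous g f
Mono⇒Homogeneous {c = c} (ys , ys⊆ , refl , pairs) =
  lookup ys , AllPairs-lookup (AllPairs-resp-⊆ ys⊆ (tabulate⁺-< id)) , c , AllPairs-lookup pairs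

ramsey : ∀ k → ∃ λ N → ∀ (f : Fin N → Fin N → Bool) →
         ∃ λ (g : Fin k → Fin N) → Increasing g × Homogeneous g f
ramsey k = ramseyBound k k , homogeneous where
  homogeneous : ∀ (f : Fin (ramseyBound k k) → Fin (ramseyBound k k) → Bool) →
                ∃ λ (g : Fin k → Fin (ramseyBound k k)) → Increasing g × Homogeneous g f
  homogeneous f
    with ramsey-list f k k (allFin (ramseyBound k k)) (ℕ.≤-reflexive (≡-sym (length-tabulate id)))
  ... | inj₁ mono = Mono⇒Homogeneous mono
  ... | inj₂ mono = Mono⇒Homogeneous mono

RamseyNumber : ℕ → ℕ → ℕ → Set
RamseyNumber q k N = ∀ (f : Fin q → Fin N → Fin N → Bool) →
  ∃ λ (g : Fin k → Fin N) → Increasing g × (∀ t → Homogeneous g (f t))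

-- The colourings are treated one at a time, each inside the set chosen for the previous one;
-- homogeneity survives passing to a subset.
ramsey-family : ∀ q k → ∃ (RamseyNumber q k)
ramsey-family zero    k = k , λ f → id , id , λ ()
ramsey-family (suc q) k =
  let N′ , family = ramsey-family q k
      N  , single = ramsey N′
  in N , λ f →
     let g , g-inc , c , g-hom = single (f f0)
         h , h-inc , h-hom     = family (λ t i j → f (fs t) (g i) (g j))
     in g ∘ h , g-inc ∘ h-inc , λ { f0 → c , g-hom ∘ h-inc ; (fs t) → h-hom t }

-- Block structure from homogeneous rows

opposite-anti-< : ∀ {n} {i j : Fin n} → i Fin.< j → opposite j Fin.< opposite i
opposite-anti-< {n} {i} {j} i<j =
  subst₂ _<_ (≡-sym (Fin.opposite-prop j)) (≡-sym (Fin.opposite-prop i))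
    (ℕ.∸-monoʳ-< (s≤s i<j) (Fin.toℕ<n j))

opposite-injective : ∀ {n} {i j : Fin n} → opposite i ≡ opposite j → i ≡ j
opposite-injective {i = i} {j} eq =
  trans (≡-sym (Fin.opposite-involutive i)) (trans (cong opposite eq) (Fin.opposite-involutive j))

inject₁-< : ∀ {n} {i j : Fin n} → i Fin.< j → inject₁ i Fin.< inject₁ j
inject₁-< {i = i} {j} = subst₂ _<_ (≡-sym (Fin.toℕ-inject₁ i)) (≡-sym (Fin.toℕ-inject₁ j))

inject₁<suc : ∀ {n} (i : Fin n) → inject₁ i Fin.< fs i
inject₁<suc i = s≤s (ℕ.≤-reflexive (Fin.toℕ-inject₁ i))

inject₁<fromℕ : ∀ {n} (i : Fin n) → inject₁ i Fin.< fromℕ n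
inject₁<fromℕ {n} i = subst₂ _<_ (≡-sym (Fin.toℕ-inject₁ i)) (≡-sym (Fin.toℕ-fromℕ n)) (Fin.toℕ<n i)

-- The values `a i` index the blocks. Injectivity is stated for `b` alone, since the inequalities
-- already separate the values of `a`.
Blocks : ∀ {X Y} → ℕ → (Fin X → Fin Y → ℕ) → Set
Blocks {X} {Y} T r =
  ∃ λ (a : Fin T → Fin X) → ∃ λ (b : Fin T → Fin Y) →
    (∀ p q → b p ≡ b q → p ≡ q) × (∀ {i j} p q → i Fin.< j → r (a i) (b p) < r (a j) (b q))

module _ {X Y : ℕ} (r : Fin X → Fin Y → ℕ) where

  Up Down : ∀ {S} → (Fin S → Fin X) → Fin Y → Fin Y → Set
  Up   a y y′ = ∀ {i j} → i Fin.< j → r (a i) y  < r (a j) y′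
  Down a y y′ = ∀ {i j} → i Fin.< j → r (a j) y′ < r (a i) y

  Up⇒opposite-Down : ∀ {S} (a : Fin S → Fin X) {y y′} → Up a y y′ → Down (a ∘ opposite) y′ y
  Up⇒opposite-Down a up = up ∘ opposite-anti-<

  Down⇒opposite-Up : ∀ {S} (a : Fin S → Fin X) {y y′} → Down a y y′ → Up (a ∘ opposite) y′ y
  Down⇒opposite-Up a down = down ∘ opposite-anti-<

  -- Each row of r is the restriction to a fixed y; Up a y y′ and Up a y′ y make rows y and y′
  -- interleave, whereas Up a y y′ and Down a y′ y put row y entirely below row y′.
  rows-separated : ∀ {T} (a : Fin (suc T) → Fin X) (b : Fin T → Fin Y) →
    (∀ i j → a i ≡ a j → i ≡ j) → (∀ p → Up a (b p) (b p)) →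
    (∀ {p q} → p Fin.< q → Up   a (b p) (b q)) →
    (∀ {p q} → p Fin.< q → Down a (b q) (b p)) →
    Blocks T (flip r)
  rows-separated a b a-inj diag up down =
    b , a ∘ inject₁ , (λ i j eq → Fin.inject₁-injective (a-inj _ _ eq)) , below
    where
    below : ∀ {p q} i j → p Fin.< q → r (a (inject₁ i)) (b p) < r (a (inject₁ j)) (b q)
    below i j p<q with Fin.<-cmp i j
    ... | tri< i<j _ _  = up p<q (inject₁-< i<j)
    -- At equal columns the comparison climbs row `p` to the next column and returns in row `q`; the
    -- extra column of `a` ensures that a next one exists.
    ... | tri≈ _ refl _ = ℕ.<-trans (diag _ (inject₁<suc i)) (down p<q (inject₁<suc i))
    ... | tri> _ _ j<i  = down p<q (inject₁-< j<i)

  rows-interleaved : ∀ {T} (a : Fin (suc T) → Fin X) (b : Fin T → Fin Y) →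
    (∀ p q → b p ≡ b q → p ≡ q) → (∀ p → Up a (b p) (b p)) →
    (∀ {p q} → p Fin.< q → Up a (b p) (b q)) →
    (∀ {p q} → p Fin.< q → Up a (b q) (b p)) →
    Blocks T r
  rows-interleaved a b b-inj diag up up′ = a ∘ inject₁ , b , b-inj , below
    where
    below : ∀ {i j} p q → i Fin.< j → r (a (inject₁ i)) (b p) < r (a (inject₁ j)) (b q)
    below p q i<j with Fin.<-cmp p q
    ... | tri< p<q _ _  = up p<q (inject₁-< i<j)
    ... | tri≈ _ refl _ = diag p (inject₁-< i<j)
    ... | tri> _ _ q<p  = up′ q<p (inject₁-< i<j)

  -- Two upward relations interleave the rows, and two opposite ones separate them, in increasing or
  -- decreasing order of the index. Two downward relations contradict `diag` already on two rows and
  -- two columns.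
  increasing-rows⇒blocks : ∀ {t} (a : Fin (3 + t) → Fin X) (b : Fin (2 + t) → Fin Y) →
    (∀ i j → a i ≡ a j → i ≡ j) → (∀ p q → b p ≡ b q → p ≡ q) →
    (∀ p → Up a (b p) (b p)) →
    (∀ {p q} → p Fin.< q → Up a (b p) (b q)) ⊎ (∀ {p q} → p Fin.< q → Down a (b p) (b q)) →
    (∀ {p q} → p Fin.< q → Up a (b q) (b p)) ⊎ (∀ {p q} → p Fin.< q → Down a (b q) (b p)) →
    Blocks (2 + t) r ⊎ Blocks (2 + t) (flip r)
  increasing-rows⇒blocks a b a-inj b-inj diag (inj₁ up) (inj₁ up′) =
    inj₁ (rows-interleaved a b b-inj diag up up′)
  increasing-rows⇒blocks a b a-inj b-inj diag (inj₁ up) (inj₂ down) =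
    inj₂ (rows-separated a b a-inj diag up down)
  increasing-rows⇒blocks a b a-inj b-inj diag (inj₂ down) (inj₁ up) =
    inj₂ (rows-separated a (b ∘ opposite) a-inj (diag ∘ opposite)
            (up ∘ opposite-anti-<) (down ∘ opposite-anti-<))
  increasing-rows⇒blocks {t} a b a-inj b-inj diag (inj₂ down) (inj₂ down′) =
    contradiction (ℕ.<-trans (ℕ.<-trans (down p<q i<j) (diag p i<j)) (down′ p<q i<j))
                  (ℕ.<⇒≯ (diag q i<j))
    where
    p q : Fin (2 + t)
    p = f0
    q = fs f0
    i j : Fin (3 + t)
    i = f0
    j = fs f0
    p<q : p Fin.< q
    p<q = s≤s z≤n
    i<j : i Fin.< j
    i<j = s≤s z≤n

  -- Reversing the columns turns `Down` into `Up` and exchanges the two rows compared, so the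
  -- decreasing case reduces to the increasing one with the last two hypotheses swapped.
  homogeneous-rows⇒blocks : ∀ {t} (a : Fin (3 + t) → Fin X) (b : Fin (2 + t) → Fin Y) →
    (∀ i j → a i ≡ a j → i ≡ j) → (∀ p q → b p ≡ b q → p ≡ q) →
    (∀ p → Up a (b p) (b p)) ⊎ (∀ p → Down a (b p) (b p)) →
    (∀ {p q} → p Fin.< q → Up a (b p) (b q)) ⊎ (∀ {p q} → p Fin.< q → Down a (b p) (b q)) →
    (∀ {p q} → p Fin.< q → Up a (b q) (b p)) ⊎ (∀ {p q} → p Fin.< q → Down a (b q) (b p)) →
    Blocks (2 + t) r ⊎ Blocks (2 + t) (flip r)
  homogeneous-rows⇒blocks a b a-inj b-inj (inj₁ diag) up⊎down up⊎down′ =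
    increasing-rows⇒blocks a b a-inj b-inj diag up⊎down up⊎down′
  homogeneous-rows⇒blocks a b a-inj b-inj (inj₂ diag) up⊎down up⊎down′ =
    increasing-rows⇒blocks (a ∘ opposite) b
      (λ i j eq → opposite-injective (a-inj _ _ eq)) b-inj
      (λ p → Down⇒opposite-Up a (diag p)) (reverse up⊎down′) (reverse up⊎down)
    where
    reverse : ∀ {c d : Fin _ → Fin _ → Fin Y} →
      (∀ {p q} → p Fin.< q → Up a (c p q) (d p q)) ⊎ (∀ {p q} → p Fin.< q → Down a (c p q) (d p q)) →
      (∀ {p q} → p Fin.< q → Up (a ∘ opposite) (d p q) (c p q)) ⊎
      (∀ {p q} → p Fin.< q → Down (a ∘ opposite) (d p q) (c p q))
    reverse (inj₁ up)   = inj₂ (λ p<q → Up⇒opposite-Down a (up p<q))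
    reverse (inj₂ down) = inj₁ (λ p<q → Down⇒opposite-Up a (down p<q))

module RamseyBlocks {t X Y : ℕ} (ramseyʸ : RamseyNumber 3 (3 + t) Y) (ramseyˣ : RamseyNumber (Y * Y) (3 + t) X)
         (r : Fin X → Fin Y → ℕ) (r-inj : ∀ x y x′ y′ → r x y ≡ r x′ y′ → x ≡ x′ × y ≡ y′) where

  less : Fin Y × Fin Y → Fin X → Fin X → Bool
  less (y , y′) x x′ = r x y <ᵇ r x′ y′

  -- There is one colouring for each pair `(y , y′)`, so that a single choice of `a` settles the
  -- comparison of all pairs of rows at once.
  chosenˣ = ramseyˣ (λ s → less (remQuot Y s))
  a = proj₁ chosenˣ
  a-inj = Increasing⇒injective (proj₁ (proj₂ chosenˣ))

  less-homogeneous : ∀ y y′ → Homogeneous a (less (y , y′))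
  less-homogeneous y y′ = subst (λ s → Homogeneous a (less s)) (Fin.remQuot-combine y y′)
                            (proj₂ (proj₂ chosenˣ) (combine y y′))

  up⊎down : ∀ y y′ → Up r a y y′ ⊎ Down r a y y′
  up⊎down y y′ with less-homogeneous y y′
  ... | true  , hom = inj₁ λ i<j → ℕ.<ᵇ⇒< _ _ (subst T (≡-sym (hom i<j)) tt)
  -- Colour `false` excludes only `<`; equality would identify `a i` with `a j`.
  ... | false , hom = inj₂ λ {i} {j} i<j → ℕ.≤∧≢⇒<
    (ℕ.≮⇒≥ (λ lt → subst T (hom i<j) (ℕ.<⇒<ᵇ lt)))
    (λ eq → Fin.<⇒≢ i<j (a-inj i j (≡-sym (proj₁ (r-inj _ _ _ _ eq)))))

  isUp : Fin Y → Fin Y → Bool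
  isUp y y′ with up⊎down y y′
  ... | inj₁ _ = true
  ... | inj₂ _ = false

  isUp⇒Up : ∀ {y y′} → isUp y y′ ≡ true → Up r a y y′
  isUp⇒Up {y} {y′} eq with up⊎down y y′
  ... | inj₁ up = up

  ¬isUp⇒Down : ∀ {y y′} → isUp y y′ ≡ false → Down r a y y′
  ¬isUp⇒Down {y} {y′} eq with up⊎down y y′
  ... | inj₂ down = down

  -- Only pairs are coloured, so the colour of the diagonal entry isUp y y is controlled for all
  -- chosen y but the last; hence one more y is chosen than needed.
  colouring : Fin 3 → Fin Y → Fin Y → Bool
  colouring f0           y y′ = isUp y y
  colouring (fs f0)      y y′ = isUp y y′
  colouring (fs (fs f0)) y y′ = isUp y′ y

  chosenʸ = ramseyʸ colouring
  b = proj₁ chosenʸ ∘ inject₁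
  b-inj : ∀ p q → b p ≡ b q → p ≡ q
  b-inj p q eq = Fin.inject₁-injective (Increasing⇒injective (proj₁ (proj₂ chosenʸ)) _ _ eq)

  split : ∀ {I : Set} {c d : I → Fin Y} → (∃ λ v → ∀ s → isUp (c s) (d s) ≡ v) →
          (∀ s → Up r a (c s) (d s)) ⊎ (∀ s → Down r a (c s) (d s))
  split (true  , eq) = inj₁ (λ s → isUp⇒Up (eq s))
  split (false , eq) = inj₂ (λ s → ¬isUp⇒Down (eq s))

  splitPairs : ∀ {c d : Fin (2 + t) → Fin (2 + t) → Fin Y} →
    (∃ λ v → ∀ {p q} → p Fin.< q → isUp (c p q) (d p q) ≡ v) →
    (∀ {p q} → p Fin.< q → Up r a (c p q) (d p q)) ⊎
    (∀ {p q} → p Fin.< q → Down r a (c p q) (d p q))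
  splitPairs (true  , eq) = inj₁ (λ p<q → isUp⇒Up (eq p<q))
  splitPairs (false , eq) = inj₂ (λ p<q → ¬isUp⇒Down (eq p<q))

  ramsey⇒blocks : Blocks (2 + t) r ⊎ Blocks (2 + t) (flip r)
  ramsey⇒blocks = homogeneous-rows⇒blocks r a b a-inj b-inj
    (let v , eq = hom f0           in split (v , λ p → eq (inject₁<fromℕ p)))
    (let v , eq = hom (fs f0)      in splitPairs {λ p _ → b p} {λ _ q → b q} (v , λ p<q → eq (inject₁-< p<q)))
    (let v , eq = hom (fs (fs f0)) in splitPairs {λ _ q → b q} {λ p _ → b p} (v , λ p<q → eq (inject₁-< p<q)))
    where hom = proj₂ (proj₂ chosenʸ)

abstract
  -- `Y` is fixed first because the choice of `X` has to handle `Y * Y` colourings. The sizes stay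
  -- opaque: later arguments see only the blocks.
  blocks : ∀ t → ∃ λ X → ∃ λ Y → ∀ (r : Fin X → Fin Y → ℕ) →
           (∀ x y x′ y′ → r x y ≡ r x′ y′ → x ≡ x′ × y ≡ y′) →
           Blocks (2 + t) r ⊎ Blocks (2 + t) (flip r)
  blocks t =
    let Y , ramseyʸ = ramsey-family 3 (3 + t)
        X , ramseyˣ = ramsey-family (Y * Y) (3 + t)
    in X , Y , RamseyBlocks.ramsey⇒blocks ramseyʸ ramseyˣ

-- Orderings avoided by the lexicographic ordering

_^_ : (G : Graph) → EdgeOrdering G → OGraph
G ^ L = record { graph = G ; order = L }

Adj-sym : ∀ G {u v} → Adj G u v → Adj G v u
Adj-sym G {u} {v} uv = trans (sym G v u) uv

Adj⇒≢ : ∀ G {u v} → Adj G u v → u ≢ v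
Adj⇒≢ G {u} uu refl with trans (≡-sym uu) (irrefl G u)
... | ()

Adj? : ∀ G u v → Dec (Adj G u v)
Adj? G u v = adj G u v Bool.≟ true

¬Adj⇒false : ∀ G {u v} → ¬ Adj G u v → adj G u v ≡ false
¬Adj⇒false G ¬uv = Bool.¬-not ¬uv

SameEdge : ∀ {N} (i j k l : Fin N) → Set
SameEdge i j k l = (i ≡ k × j ≡ l) ⊎ (i ≡ l × j ≡ k)

SameEdge? : ∀ {N} (i j k l : Fin N) → Dec (SameEdge i j k l)
SameEdge? i j k l = (i Fin.≟ k ×-dec j Fin.≟ l) ⊎-dec (i Fin.≟ l ×-dec j Fin.≟ k)

-- On `Fin N`, `combine i j` is `N * i + j`, whence the order by minimum and then maximum.
lex : ∀ {N} → Fin N → Fin N → ℕ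
lex i j with i Fin.≤? j
... | yes _ = toℕ (combine i j)
... | no  _ = toℕ (combine j i)

lex-sym : ∀ {N} (i j : Fin N) → lex i j ≡ lex j i
lex-sym i j with i Fin.≤? j | j Fin.≤? i
... | yes i≤j | yes j≤i = cong₂ (λ k l → toℕ (combine k l))
                            (Fin.≤-antisym i≤j j≤i) (Fin.≤-antisym j≤i i≤j)
... | yes _   | no  _   = refl
... | no  _   | yes _   = refl
... | no  i≰j | no  j≰i = contradiction (ℕ.<⇒≤ (ℕ.≰⇒> i≰j)) j≰i

lex-injective : ∀ {N} (i j k l : Fin N) → lex i j ≡ lex k l → SameEdge i j k l
lex-injective i j k l eq with i Fin.≤? j | k Fin.≤? l
... | yes _ | yes _ = inj₁ (Fin.combine-injective i j k l (Fin.toℕ-injective eq))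
... | yes _ | no  _ = inj₂ (Fin.combine-injective i j l k (Fin.toℕ-injective eq))
... | no  _ | yes _ = let j≡k , i≡l = Fin.combine-injective j i k l (Fin.toℕ-injective eq) in inj₂ (i≡l , j≡k)
... | no  _ | no  _ = let j≡l , i≡k = Fin.combine-injective j i l k (Fin.toℕ-injective eq) in inj₁ (i≡k , j≡l)

lex-< : ∀ {N} {x y p q : Fin N} → x Fin.≤ y → x Fin.< p → x Fin.< q → lex x y < lex p q
lex-< {x = x} {y} {p} {q} x≤y x<p x<q with x Fin.≤? y | p Fin.≤? q
... | yes _   | yes _ = Fin.combine-monoˡ-< y q x<p
... | yes _   | no  _ = Fin.combine-monoˡ-< y p x<q
... | no  x≰y | _     = contradiction x≤y x≰y

minOrdering : ∀ G → EdgeOrdering G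
minOrdering G = record
  { rank     = lex
  ; rank-sym = lex-sym
  ; rank-inj = λ i j k l _ _ → lex-injective i j k l
  }

minimiser : ∀ {N} → 1 ≤ N → (h : Fin N → ℕ) → ∃ λ x → ∀ y → h x ≤ h y
minimiser {suc N} _ h = argmin h f0 (allFin _) ,
  λ y → All.lookup (f[argmin]≤f[xs] {f = h} f0 (allFin _)) (∈-allFin y)

-- A certificate that no copy in the min-ordering has `x` as its smallest vertex: there `x y` would
-- have to come before `p q`.
Blocked : (G : Graph) → EdgeOrdering G → Fin (n G) → Set
Blocked G L x = ∃ λ p → ∃ λ q → ∃ λ y →
  Adj G p q × x ≢ p × x ≢ q × Adj G x y × rank L p q < rank L x y

-- In the min-ordering the edges at the smallest vertex of a copy of G precede all other edges.
blocked⇒avoidable : ∀ G L → NonEmpty G → (∀ x → Blocked G L x) →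
                    ∀ G′ → CanAvoid G′ (G ^ L)
blocked⇒avoidable G L nonempty blocked G′ = minOrdering G′ , avoids
  where
  avoids : ¬ Contains G′ (minOrdering G′) (G ^ L)
  avoids (f , f-inj , _ , f-ord) =
    let x , x-min = minimiser nonempty (λ v → toℕ (f v))
        above : ∀ {v} → x ≢ v → f x Fin.< f v
        above x≢v = Fin.≤∧≢⇒< (x-min _) (λ eq → x≢v (f-inj _ _ eq))
        p , q , y , pq , x≢p , x≢q , xy , lt = blocked x
    in ℕ.<-asym (proj₁ (f-ord p q x y pq xy) lt) (lex-< (x-min y) (above x≢p) (above x≢q))

module _ {G : Graph} (L : EdgeOrdering G) (u v : Fin (n G)) where

  -- Moves one edge to the beginning and keeps the order of the others. In nested uses the outermost
  -- edge comes first.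
  frontRank : Fin (n G) → Fin (n G) → ℕ
  frontRank i j with SameEdge? i j u v
  ... | yes _ = 0
  ... | no  _ = suc (rank L i j)

  frontRank-sym : ∀ i j → frontRank i j ≡ frontRank j i
  frontRank-sym i j with SameEdge? i j u v | SameEdge? j i u v
  ... | yes _ | yes _ = refl
  ... | yes (inj₁ (i≡ , j≡)) | no ¬same = contradiction (inj₂ (j≡ , i≡)) ¬same
  ... | yes (inj₂ (i≡ , j≡)) | no ¬same = contradiction (inj₁ (j≡ , i≡)) ¬same
  ... | no ¬same | yes (inj₁ (j≡ , i≡)) = contradiction (inj₂ (i≡ , j≡)) ¬same
  ... | no ¬same | yes (inj₂ (j≡ , i≡)) = contradiction (inj₁ (i≡ , j≡)) ¬same
  ... | no _  | no _  = cong suc (rank-sym L i j)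

  frontRank-inj : ∀ i j k l → Adj G i j → Adj G k l → frontRank i j ≡ frontRank k l → SameEdge i j k l
  frontRank-inj i j k l ij kl eq with SameEdge? i j u v | SameEdge? k l u v
  ... | yes (inj₁ (refl , refl)) | yes (inj₁ (refl , refl)) = inj₁ (refl , refl)
  ... | yes (inj₁ (refl , refl)) | yes (inj₂ (refl , refl)) = inj₂ (refl , refl)
  ... | yes (inj₂ (refl , refl)) | yes (inj₁ (refl , refl)) = inj₂ (refl , refl)
  ... | yes (inj₂ (refl , refl)) | yes (inj₂ (refl , refl)) = inj₁ (refl , refl)
  ... | no _ | no _ = rank-inj L i j k l ij kl (ℕ.suc-injective eq)

  front : EdgeOrdering G
  front = record { rank = frontRank ; rank-sym = frontRank-sym ; rank-inj = frontRank-inj }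

  front-head-< : ∀ {i j} → ¬ SameEdge i j u v → rank front u v < rank front i j
  front-head-< {i} {j} ¬same with SameEdge? u v u v | SameEdge? i j u v
  ... | yes _ | no _     = s≤s z≤n
  ... | yes _ | yes same = contradiction same ¬same
  ... | no ¬refl | _     = contradiction (inj₁ (refl , refl)) ¬refl

  front-tail-< : ∀ {i j k l} → ¬ SameEdge i j u v → ¬ SameEdge k l u v →
                 rank L i j < rank L k l → rank front i j < rank front k l
  front-tail-< {i} {j} {k} {l} ¬ij ¬kl lt with SameEdge? i j u v | SameEdge? k l u v
  ... | no _     | no _     = s≤s lt
  ... | yes same | _        = contradiction same ¬ij
  ... | no _     | yes same = contradiction same ¬kl

-- Recognition of K3, P4 and star forests

≢⇒K3-adj : ∀ i j → i ≢ j → Adj K3 i j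
≢⇒K3-adj = from-yes (all? λ i → all? λ j → ¬? (i Fin.≟ j) →-dec Adj? K3 i j)

bijection⇒Iso : ∀ {G H} (g : Fin (n H) → Fin (n G)) → (∀ i j → g i ≡ g j → i ≡ j) →
  (∀ x → ∃ λ i → g i ≡ x) → (∀ i j → adj H i j ≡ adj G (g i) (g j)) → Iso G H
bijection⇒Iso {G} g g-inj g-surj g-adj = record
  { to       = λ x → proj₁ (g-surj x)
  ; from     = g
  ; from-to  = λ x → proj₂ (g-surj x)
  ; to-from  = λ i → g-inj _ _ (proj₂ (g-surj (g i)))
  ; adj-pres = λ x y → trans (g-adj _ _) (cong₂ (adj G) (proj₂ (g-surj x)) (proj₂ (g-surj y)))
  }

module _ (G : Graph) where

  -- `w` and `z` may coincide, which gives a triangle; otherwise `w`, `u`, `v`, `z` form a path.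
  NonStarEdge : Set
  NonStarEdge = ∃ λ u → ∃ λ v → ∃ λ w → ∃ λ z →
    Adj G u v × (Adj G u w × w ≢ v) × (Adj G v z × z ≢ u)

  nonStarEdge? : Dec NonStarEdge
  nonStarEdge? = any? λ u → any? λ v → any? λ w → any? λ z →
    Adj? G u v ×-dec ((Adj? G u w ×-dec ¬? (w Fin.≟ v)) ×-dec (Adj? G v z ×-dec ¬? (z Fin.≟ u)))

  -- What remains when no edge is disjoint from `u v` and neither end has a third neighbour. The
  -- case `w ≡ z` is included.
  IsolatedPath : Fin (n G) → Fin (n G) → Fin (n G) → Fin (n G) → Set
  IsolatedPath w u v z = (∀ {p q} → Adj G p q → (u ≡ p ⊎ u ≡ q) ⊎ (v ≡ p ⊎ v ≡ q))
    × (∀ {t} → Adj G u t → t ≡ v ⊎ t ≡ w) × (∀ {t} → Adj G v t → t ≡ u ⊎ t ≡ z)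

  CentredAt : Fin (n G) → Set
  CentredAt c = ∀ {y t} → Adj G c y → Adj G y t → t ≡ c

  -- The closed neighbourhood of `c` is stable under steps along edges.
  reach-centred : ∀ {c} → CentredAt c → ∀ {v u} → v ≡ c ⊎ Adj G c v → Reach G v u → u ≡ c ⊎ Adj G c u
  reach-centred centred near here = near
  reach-centred centred (inj₁ refl) (step vy reach) = reach-centred centred (inj₂ vy) reach
  reach-centred centred (inj₂ cv) (step vy reach) = reach-centred centred (inj₁ (centred cv vy)) reach

  centred⇒star : ∀ {c v} → CentredAt c → v ≡ c ⊎ Adj G c v → ComponentIsStar G v
  centred⇒star {c} {v} centred near = c , to-centre near , edges , spokes
    where
    to-centre : v ≡ c ⊎ Adj G c v → Reach G v c
    to-centre (inj₁ refl) = here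
    to-centre (inj₂ cv)   = step (Adj-sym G cv) here
    edges : ∀ u w → Reach G v u → Reach G v w → Adj G u w → u ≡ c ⊎ w ≡ c
    edges u w vu _ uw with reach-centred centred near vu
    ... | inj₁ u≡c = inj₁ u≡c
    ... | inj₂ cu  = inj₂ (centred cu uw)
    spokes : ∀ u → Reach G v u → u ≢ c → Adj G c u
    spokes u vu u≢c with reach-centred centred near vu
    ... | inj₁ u≡c = contradiction u≡c u≢c
    ... | inj₂ cu  = cu

module _ (G : Graph) (noIso : NoIsolatedVertices G) where

  -- The first edge `u v` itself blocks every vertex outside it, since such a vertex has some edge
  -- and that edge comes later.
  blocked-off-edge : ∀ {L : EdgeOrdering G} {u v} → Adj G u v →
    (∀ {i j} → ¬ SameEdge i j u v → rank L u v < rank L i j) →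
    Blocked G L u → Blocked G L v → ∀ x → Blocked G L x
  blocked-off-edge {L} {u} {v} uv first blockedᵘ blockedᵛ x with x Fin.≟ u | x Fin.≟ v
  ... | yes refl | _        = blockedᵘ
  ... | no _     | yes refl = blockedᵛ
  ... | no x≢u   | no x≢v   =
    let y , xy = noIso x
    in u , v , y , uv , x≢u , x≢v , xy ,
       first (λ { (inj₁ (x≡u , _)) → x≢u x≡u ; (inj₂ (x≡v , _)) → x≢v x≡v })

  -- The ordering begins with `u v`, `p q`. Then `p q` avoids both `u` and `v` and precedes `u w`
  -- and `v z`.
  disjointEdge⇒ordering : ∀ {u v w z p q} → Adj G u v →
    Adj G u w → w ≢ v → Adj G v z → z ≢ u →
    Adj G p q → u ≢ p → u ≢ q → v ≢ p → v ≢ q →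
    ∃ λ (L : EdgeOrdering G) → ∀ x → Blocked G L x
  disjointEdge⇒ordering {u} {v} {w} {z} {p} {q} uv uw w≢v vz z≢u pq u≢p u≢q v≢p v≢q =
    L , blocked-off-edge {L} uv (front-head-< _ u v)
      (p , q , w , pq , u≢p , u≢q , uw , front-tail-< _ u v pq≠uv
         (λ { (inj₁ (_ , w≡v)) → w≢v w≡v ; (inj₂ (u≡v , _)) → Adj⇒≢ G uv u≡v })
         (front-head-< _ p q (λ { (inj₁ (u≡p , _)) → u≢p u≡p ; (inj₂ (u≡q , _)) → u≢q u≡q })))
      (p , q , z , pq , v≢p , v≢q , vz , front-tail-< _ u v pq≠uv
         (λ { (inj₁ (v≡u , _)) → Adj⇒≢ G uv (≡-sym v≡u) ; (inj₂ (_ , z≡u)) → z≢u z≡u })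
         (front-head-< _ p q (λ { (inj₁ (v≡p , _)) → v≢p v≡p ; (inj₂ (v≡q , _)) → v≢q v≡q })))
    where
    L = front (front (minOrdering G) p q) u v
    pq≠uv : ¬ SameEdge p q u v
    pq≠uv (inj₁ (p≡u , _)) = u≢p (≡-sym p≡u)
    pq≠uv (inj₂ (p≡v , _)) = v≢p (≡-sym p≡v)

  -- The ordering begins with `u v`, `u w`, `v z`. The end `u` is blocked by `v z` before `u t`, and
  -- the end `v` by `u w` before `v z`.
  degree3⇒ordering : ∀ {u v w t z} → Adj G u v →
    Adj G u w → w ≢ v → Adj G u t → t ≢ v → t ≢ w → Adj G v z → z ≢ u →
    ∃ λ (L : EdgeOrdering G) → ∀ x → Blocked G L x
  degree3⇒ordering {u} {v} {w} {t} {z} uv uw w≢v ut t≢v t≢w vz z≢u =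
    L , blocked-off-edge {L} uv (front-head-< _ u v)
      (v , z , t , vz , u≢v , z≢u ∘ ≡-sym , ut ,
         front-tail-< _ u v vz≠uv (at-u≠uv t≢v)
           (front-tail-< _ u w vz≠uw
             (λ { (inj₁ (_ , t≡w)) → t≢w t≡w ; (inj₂ (u≡w , _)) → Adj⇒≢ G uw u≡w })
             (front-head-< _ v z
               (λ { (inj₁ (u≡v , _)) → u≢v u≡v ; (inj₂ (u≡z , _)) → z≢u (≡-sym u≡z) }))))
      (u , w , z , uw , u≢v ∘ ≡-sym , w≢v ∘ ≡-sym , vz ,
         front-tail-< _ u v (at-u≠uv w≢v) vz≠uv (front-head-< _ u w vz≠uw))
    where
    L = front (front (front (minOrdering G) v z) u w) u v
    u≢v = Adj⇒≢ G uv
    vz≠uv : ¬ SameEdge v z u v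
    vz≠uv (inj₁ (v≡u , _)) = u≢v (≡-sym v≡u)
    vz≠uv (inj₂ (_ , z≡u)) = z≢u z≡u
    vz≠uw : ¬ SameEdge v z u w
    vz≠uw (inj₁ (v≡u , _)) = u≢v (≡-sym v≡u)
    vz≠uw (inj₂ (v≡w , _)) = w≢v (≡-sym v≡w)
    at-u≠uv : ∀ {y} → y ≢ v → ¬ SameEdge u y u v
    at-u≠uv y≢v (inj₁ (_ , y≡v)) = y≢v y≡v
    at-u≠uv y≢v (inj₂ (u≡v , _)) = u≢v u≡v

  nonStarEdge⇒ordering⊎path : ∀ {w u v z} → Adj G u v → Adj G u w → w ≢ v → Adj G v z → z ≢ u →
    (∃ λ (L : EdgeOrdering G) → ∀ x → Blocked G L x) ⊎ IsolatedPath G w u v z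
  nonStarEdge⇒ordering⊎path {w} {u} {v} {z} uv uw w≢v vz z≢u
    with any? (λ p → any? λ q → Adj? G p q ×-dec
           ¬? ((u Fin.≟ p ⊎-dec u Fin.≟ q) ⊎-dec (v Fin.≟ p ⊎-dec v Fin.≟ q)))
       | any? (λ t → Adj? G u t ×-dec ¬? (t Fin.≟ v ⊎-dec t Fin.≟ w))
       | any? (λ t → Adj? G v t ×-dec ¬? (t Fin.≟ u ⊎-dec t Fin.≟ z))
  ... | yes (p , q , pq , disjoint) | _ | _ = inj₁ (disjointEdge⇒ordering uv uw w≢v vz z≢u pq
          (disjoint ∘ inj₁ ∘ inj₁) (disjoint ∘ inj₁ ∘ inj₂) (disjoint ∘ inj₂ ∘ inj₁) (disjoint ∘ inj₂ ∘ inj₂))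
  ... | no _ | yes (t , ut , t∉) | _ = inj₁ (degree3⇒ordering uv uw w≢v ut (t∉ ∘ inj₁) (t∉ ∘ inj₂) vz z≢u)
  -- A third neighbour of `v`: the previous case with the edge reversed.
  ... | no _ | no _ | yes (t , vt , t∉) =
    inj₁ (degree3⇒ordering (Adj-sym G uv) vz z≢u vt (t∉ ∘ inj₁) (t∉ ∘ inj₂) uw w≢v)
  ... | no ∄pq | no ∄ut | no ∄vt = inj₂
    ( (λ {p} {q} pq → decidable-stable ((u Fin.≟ p ⊎-dec u Fin.≟ q) ⊎-dec (v Fin.≟ p ⊎-dec v Fin.≟ q))
        (λ disjoint → ∄pq (p , q , pq , disjoint)))
    , (λ {t} ut → decidable-stable (t Fin.≟ v ⊎-dec t Fin.≟ w) (λ t∉ → ∄ut (t , ut , t∉)))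
    , (λ {t} vt → decidable-stable (t Fin.≟ u ⊎-dec t Fin.≟ z) (λ t∉ → ∄vt (t , vt , t∉))))

  -- `x` has an edge, and this edge meets `u` or `v`: either `x` is that end or it is one of the
  -- listed neighbours of that end.
  path-covers : ∀ {w u v z} → IsolatedPath G w u v z → ∀ x → (x ≡ u ⊎ x ≡ v) ⊎ (x ≡ w ⊎ x ≡ z)
  path-covers (covers , atᵘ , atᵛ) x with noIso x
  ... | y , xy with covers xy
  ...   | inj₁ (inj₁ u≡x) = inj₁ (inj₁ (≡-sym u≡x))
  ...   | inj₂ (inj₁ v≡x) = inj₁ (inj₂ (≡-sym v≡x))
  ...   | inj₁ (inj₂ refl) with atᵘ (Adj-sym G xy)
  ...     | inj₁ x≡v = inj₁ (inj₂ x≡v)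
  ...     | inj₂ x≡w = inj₂ (inj₁ x≡w)
  path-covers (covers , atᵘ , atᵛ) x | y , xy | inj₂ (inj₂ refl) with atᵛ (Adj-sym G xy)
  ...     | inj₁ x≡u = inj₁ (inj₁ x≡u)
  ...     | inj₂ x≡z = inj₂ (inj₂ x≡z)

  triangle⇒K3 : ∀ {u v w} → Adj G u v → Adj G u w → Adj G v w → IsolatedPath G w u v w → Iso G K3
  triangle⇒K3 {u} {v} {w} uv uw vw path = bijection⇒Iso g g-inj g-surj g-adj
    where
    g : Fin 3 → Fin (n G)
    g f0           = u
    g (fs f0)      = v
    g (fs (fs f0)) = w
    g-adj : ∀ i j → k3adj i j ≡ adj G (g i) (g j)
    g-adj f0           f0           = ≡-sym (irrefl G u)
    g-adj f0           (fs f0)      = ≡-sym uv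
    g-adj f0           (fs (fs f0)) = ≡-sym uw
    g-adj (fs f0)      f0           = ≡-sym (Adj-sym G uv)
    g-adj (fs f0)      (fs f0)      = ≡-sym (irrefl G v)
    g-adj (fs f0)      (fs (fs f0)) = ≡-sym vw
    g-adj (fs (fs f0)) f0           = ≡-sym (Adj-sym G uw)
    g-adj (fs (fs f0)) (fs f0)      = ≡-sym (Adj-sym G vw)
    g-adj (fs (fs f0)) (fs (fs f0)) = ≡-sym (irrefl G w)
    g-inj : ∀ i j → g i ≡ g j → i ≡ j
    g-inj i j eq with i Fin.≟ j
    ... | yes i≡j = i≡j
    ... | no  i≢j = contradiction eq (Adj⇒≢ G (trans (≡-sym (g-adj i j)) (≢⇒K3-adj i j i≢j)))
    g-surj : ∀ x → ∃ λ i → g i ≡ x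
    g-surj x with path-covers path x
    ... | inj₁ (inj₁ refl) = f0 , refl
    ... | inj₁ (inj₂ refl) = fs f0 , refl
    ... | inj₂ (inj₁ refl) = fs (fs f0) , refl
    ... | inj₂ (inj₂ refl) = fs (fs f0) , refl

  -- Chords at `u` or `v` would be third neighbours, and an edge `w z` would miss both `u` and `v`.
  path⇒P4 : ∀ {w u v z} → Adj G u v → Adj G u w → w ≢ v → Adj G v z → z ≢ u → w ≢ z →
            IsolatedPath G w u v z → Iso G P4
  path⇒P4 {w} {u} {v} {z} uv uw w≢v vz z≢u w≢z path@(covers , atᵘ , atᵛ) =
    bijection⇒Iso g g-inj g-surj g-adj
    where
    g : Fin 4 → Fin (n G)
    g f0                = w
    g (fs f0)           = u
    g (fs (fs f0))      = v
    g (fs (fs (fs f0))) = z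
    u≢v = Adj⇒≢ G uv
    u≢w = Adj⇒≢ G uw
    v≢z = Adj⇒≢ G vz
    vw : adj G v w ≡ false
    vw = ¬Adj⇒false G λ vw → [ u≢w ∘ ≡-sym , w≢z ] (atᵛ vw)
    uz : adj G u z ≡ false
    uz = ¬Adj⇒false G λ uz → [ v≢z ∘ ≡-sym , w≢z ∘ ≡-sym ] (atᵘ uz)
    wz : adj G w z ≡ false
    wz = ¬Adj⇒false G λ wz →
      [ (λ { (inj₁ u≡w) → u≢w u≡w ; (inj₂ u≡z) → z≢u (≡-sym u≡z) })
      , (λ { (inj₁ v≡w) → w≢v (≡-sym v≡w) ; (inj₂ v≡z) → v≢z v≡z })
      ] (covers wz)
    upper : ∀ i j → i Fin.< j → p4adj i j ≡ adj G (g i) (g j)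
    upper f0           (fs f0)           _ = ≡-sym (Adj-sym G uw)
    upper f0           (fs (fs f0))      _ = ≡-sym (trans (sym G w v) vw)
    upper f0           (fs (fs (fs f0))) _ = ≡-sym wz
    upper (fs f0)      (fs (fs f0))      _ = ≡-sym uv
    upper (fs f0)      (fs (fs (fs f0))) _ = ≡-sym uz
    upper (fs (fs f0)) (fs (fs (fs f0))) _ = ≡-sym vz
    upper f0           f0                ()
    upper (fs f0)      f0                ()
    upper (fs f0)      (fs f0)           (s≤s ())
    upper (fs (fs f0)) f0                ()
    upper (fs (fs f0)) (fs f0)           (s≤s ())
    upper (fs (fs f0)) (fs (fs f0))      (s≤s (s≤s ()))
    upper (fs (fs (fs f0))) (fs (fs (fs f0))) (s≤s (s≤s (s≤s ())))
    g-adj : ∀ i j → p4adj i j ≡ adj G (g i) (g j)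
    g-adj i j with Fin.<-cmp i j
    ... | tri< i<j _ _  = upper i j i<j
    ... | tri≈ _ refl _ = trans (p4irr i) (≡-sym (irrefl G (g i)))
    ... | tri> _ _ j<i  = trans (p4sym i j) (trans (upper j i j<i) (sym G (g j) (g i)))
    distinct : ∀ i j → i Fin.< j → g i ≢ g j
    distinct f0           (fs f0)           _ = u≢w ∘ ≡-sym
    distinct f0           (fs (fs f0))      _ = w≢v
    distinct f0           (fs (fs (fs f0))) _ = w≢z
    distinct (fs f0)      (fs (fs f0))      _ = u≢v
    distinct (fs f0)      (fs (fs (fs f0))) _ = z≢u ∘ ≡-sym
    distinct (fs (fs f0)) (fs (fs (fs f0))) _ = v≢z
    distinct f0           f0                ()
    distinct (fs f0)      f0                ()
    distinct (fs f0)      (fs f0)           (s≤s ())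
    distinct (fs (fs f0)) f0                ()
    distinct (fs (fs f0)) (fs f0)           (s≤s ())
    distinct (fs (fs f0)) (fs (fs f0))      (s≤s (s≤s ()))
    distinct (fs (fs (fs f0))) (fs (fs (fs f0))) (s≤s (s≤s (s≤s ())))
    g-inj : ∀ i j → g i ≡ g j → i ≡ j
    g-inj i j eq with Fin.<-cmp i j
    ... | tri< i<j _ _ = contradiction eq (distinct i j i<j)
    ... | tri≈ _ i≡j _ = i≡j
    ... | tri> _ _ j<i = contradiction (≡-sym eq) (distinct j i j<i)
    g-surj : ∀ x → ∃ λ i → g i ≡ x
    g-surj x with path-covers path x
    ... | inj₁ (inj₁ refl) = fs f0 , refl
    ... | inj₁ (inj₂ refl) = fs (fs f0) , refl
    ... | inj₂ (inj₁ refl) = f0 , refl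
    ... | inj₂ (inj₂ refl) = fs (fs (fs f0)) , refl

  nonStarEdge⇒ordering : ¬ Iso G P4 → ¬ Iso G K3 → NonStarEdge G →
    ∃ λ (L : EdgeOrdering G) → ∀ x → Blocked G L x
  nonStarEdge⇒ordering ¬P4 ¬K3 (u , v , w , z , uv , (uw , w≢v) , (vz , z≢u))
    with nonStarEdge⇒ordering⊎path uv uw w≢v vz z≢u
  ... | inj₁ ordering = ordering
  ... | inj₂ path with w Fin.≟ z
  ...   | yes refl = contradiction (triangle⇒K3 uv uw vz path) ¬K3
  ...   | no  w≢z  = contradiction (path⇒P4 uv uw w≢v vz z≢u w≢z path) ¬P4

  -- A vertex with two neighbours is the centre of its component. Otherwise its only neighbour is.
  noNonStarEdge⇒starForest : NonEmpty G → ¬ NonStarEdge G → IsStarForest G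
  noNonStarEdge⇒starForest nonempty none = nonempty , component
    where
    component : ∀ v → ComponentIsStar G v
    component v with noIso v
    ... | u , vu with any? (λ w → Adj? G v w ×-dec ¬? (w Fin.≟ u))
    ...   | yes (w , vw , w≢u) = centred⇒star G centredᵛ (inj₁ refl)
      where
      other : ∀ y → ∃ λ x → Adj G v x × x ≢ y
      other y with u Fin.≟ y
      ... | yes refl = w , vw , w≢u
      ... | no  u≢y  = u , vu , u≢y
      centredᵛ : CentredAt G v
      centredᵛ {y} {t} vy yt = decidable-stable (t Fin.≟ v) λ t≢v →
        let x , vx , x≢y = other y in none (v , y , x , t , vy , (vx , x≢y) , (yt , t≢v))
    ...   | no pendant = centred⇒star G centredᵘ (inj₂ (Adj-sym G vu))
      where
      centredᵘ : CentredAt G u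
      centredᵘ {y} {t} uy yt with t Fin.≟ u | v Fin.≟ y
      ... | yes t≡u | _        = t≡u
      ... | no  t≢u | yes refl = contradiction (t , yt , t≢u) pendant
      ... | no  t≢u | no  v≢y  =
        contradiction (u , y , v , t , uy , (Adj-sym G vu , v≢y) , (yt , t≢u)) none

  chiPlus-∞ : NonEmpty G → ¬ IsStarForest G → ¬ Iso G P4 → ¬ Iso G K3 → ChiPlus G ∞
  chiPlus-∞ nonempty ¬star ¬P4 ¬K3 with nonStarEdge? G
  ... | no  none    = contradiction (noNonStarEdge⇒starForest nonempty none) ¬star
  ... | yes nonStar =
    let L , blocked = nonStarEdge⇒ordering ¬P4 ¬K3 nonStar
    in (L , blocked⇒avoidable G L nonempty blocked) , λ _ w _ → w ≤∞∞

-- Finite values and star forests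

clique⇒≤ : ∀ G {m k} (f : Fin m → Fin (n G)) → (∀ i j → i ≢ j → Adj G (f i) (f j)) →
           Colourable G k → m ≤ k
clique⇒≤ G {m} f clique (c , proper) = Fin.injective⇒≤ {f = c ∘ f} injective
  where
  injective : ∀ {i j} → c (f i) ≡ c (f j) → i ≡ j
  injective {i} {j} eq = decidable-stable (i Fin.≟ j) (λ i≢j → proper _ _ (clique i j i≢j) eq)

edge⇒2≤ : ∀ G {u v k} → Adj G u v → Colourable G k → 2 ≤ k
edge⇒2≤ G {u} {v} uv = clique⇒≤ G (Vec.lookup (u ∷ v ∷ [])) clique
  where
  clique : ∀ i j → i ≢ j → Adj G (Vec.lookup (u ∷ v ∷ []) i) (Vec.lookup (u ∷ v ∷ []) j)
  clique f0      f0      i≢j = contradiction refl i≢j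
  clique f0      (fs f0) _   = uv
  clique (fs f0) f0      _   = Adj-sym G uv
  clique (fs f0) (fs f0) i≢j = contradiction refl i≢j

Contains⇒Colourable : ∀ {G L H k} → Contains G L H → Colourable G k → Colourable (graph H) k
Contains⇒Colourable (f , _ , f-adj , _) (c , proper) = c ∘ f , λ u v uv → proper _ _ (f-adj u v uv)

-- Every ordering has order chromatic number exactly `m`, because a copy of `G` pulls colourings
-- back to `G`; the maximum is taken over equal values.
chiPlus-fin : ∀ G m → (∀ k → Colourable G k → m ≤ k) →
  (∀ L → ∃ λ G′ → ChromaticNumber G′ m × (∀ L′ → Contains G′ L′ (G ^ L))) →
  ChiPlus G (fin m)
chiPlus-fin G m lower unavoidable = (minOrdering G , value (minOrdering G)) , upper
  where
  value : ∀ L → OrderChromaticNumber (G ^ L) (fin m)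
  value L =
    let G′ , χ , contains = unavoidable L
    in (G′ , χ , λ { (L′ , avoids) → avoids (contains L′) }) ,
       -- Unavoidability only refutes avoidance; decidability of `m ≤ k` removes the double
       -- negation.
       λ G″ k (colourable , _) unavoid → decidable-stable (m ≤? k) λ m≰k → unavoid
         (minOrdering G″ , λ copy → m≰k (lower k (Contains⇒Colourable {G″} {minOrdering G″} {G ^ L} copy colourable)))
  upper : ∀ L w → OrderChromaticNumber (G ^ L) w → w ≤∞ fin m
  upper L (fin k) (_ , minimal) =
    let G′ , χ , contains = unavoidable L
    in fin≤fin (minimal G′ m χ (λ { (L′ , avoids) → avoids (contains L′) }))
  upper L ∞ avoidable =
    let G′ , _ , contains = unavoidable L
        L′ , avoids = avoidable G′
    in contradiction (contains L′) avoids

-- By trichotomy the order is also reflected: equal ranks in `H` mean the same edge, whose image has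
-- only one rank.
forward⇒Contains : ∀ {G L H} (f : Fin (n (graph H)) → Fin (n G)) → (∀ x y → f x ≡ f y → x ≡ y) →
  (∀ x y → Adj (graph H) x y → Adj G (f x) (f y)) →
  (∀ x y x′ y′ → Adj (graph H) x y → Adj (graph H) x′ y′ →
     rank (order H) x y < rank (order H) x′ y′ → rank L (f x) (f y) < rank L (f x′) (f y′)) →
  Contains G L H
forward⇒Contains {G} {L} {H} f f-inj f-adj forward =
  f , f-inj , f-adj , λ x y x′ y′ xy x′y′ → forward x y x′ y′ xy x′y′ , backward x y x′ y′ xy x′y′
  where
  backward : ∀ x y x′ y′ → Adj (graph H) x y → Adj (graph H) x′ y′ →
    rank L (f x) (f y) < rank L (f x′) (f y′) → rank (order H) x y < rank (order H) x′ y′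
  backward x y x′ y′ xy x′y′ lt with ℕ.<-cmp (rank (order H) x y) (rank (order H) x′ y′)
  ... | tri< lt′ _ _ = lt′
  ... | tri> _ _ gt  = contradiction (forward x′ y′ x y x′y′ xy gt) (ℕ.<⇒≯ lt)
  ... | tri≈ _ eq _ with rank-inj (order H) x y x′ y′ xy x′y′ eq
  ...   | inj₁ (refl , refl) = contradiction lt (ℕ.<-irrefl refl)
  ...   | inj₂ (refl , refl) = contradiction lt (ℕ.<-irrefl (rank-sym L (f x) (f y)))

-- A block structure on vertices of `G`. It no longer records which side of the bipartition carries
-- the blocks.
record Grid (T : ℕ) (G : Graph) (L : EdgeOrdering G) : Set where
  field
    a b   : Fin T → Fin (n G)
    b-inj : ∀ p q → b p ≡ b q → p ≡ q
    a-b   : ∀ i p → Adj G (a i) (b p)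
    below : ∀ {i j} p q → i Fin.< j → rank L (a i) (b p) < rank L (a j) (b q)

  a-inj : ∀ i j → a i ≡ a j → i ≡ j
  a-inj i j eq with Fin.<-cmp i j
  ... | tri< i<j _ _ = contradiction (below i i i<j) (ℕ.<-irrefl (cong (λ x → rank L x (b i)) eq))
  ... | tri≈ _ i≡j _ = i≡j
  ... | tri> _ _ j<i = contradiction (below i i j<i) (ℕ.<-irrefl (cong (λ x → rank L x (b i)) (≡-sym eq)))

module _ (X Y : ℕ) where

  sideOf : Fin X ⊎ Fin Y → Bool
  sideOf (inj₁ _) = true
  sideOf (inj₂ _) = false

  side : Fin (X + Y) → Bool
  side v = sideOf (splitAt X v)

  completeBipartite : Graph
  completeBipartite = record
    { n      = X + Y
    ; adj    = λ u v → side u xor side v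
    ; sym    = λ u v → Bool.xor-comm (side u) (side v)
    ; irrefl = λ v → Bool.xor-same (side v)
    }

  colour : Bool → Fin 2
  colour true  = f0
  colour false = fs f0

  completeBipartite-2-colourable : Colourable completeBipartite 2
  completeBipartite-2-colourable = colour ∘ side , λ u v → proper (side u) (side v)
    where
    proper : ∀ s t → s xor t ≡ true → colour s ≢ colour t
    proper true  false _ ()
    proper false true  _ ()

  across : ∀ x y → Adj completeBipartite (x ↑ˡ Y) (X ↑ʳ y)
  across x y rewrite Fin.splitAt-↑ˡ X x Y | Fin.splitAt-↑ʳ X Y y = refl

  left≢right : ∀ x y → x ↑ˡ Y ≢ X ↑ʳ y
  left≢right x y = Adj⇒≢ completeBipartite (across x y)

  module _ (L : EdgeOrdering completeBipartite) where

    weight : Fin X → Fin Y → ℕ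
    weight x y = rank L (x ↑ˡ Y) (X ↑ʳ y)

    weight-inj : ∀ x y x′ y′ → weight x y ≡ weight x′ y′ → x ≡ x′ × y ≡ y′
    weight-inj x y x′ y′ eq with rank-inj L _ _ _ _ (across x y) (across x′ y′) eq
    ... | inj₁ (eqˣ , eqʸ) = Fin.↑ˡ-injective Y _ _ eqˣ , Fin.↑ʳ-injective X _ _ eqʸ
    ... | inj₂ (eq′ , _)   = contradiction eq′ (left≢right x y′)

    blocks⇒grid : ∀ {T} → Blocks T weight ⊎ Blocks T (flip weight) → Grid T completeBipartite L
    blocks⇒grid (inj₁ (a , b , b-inj , below)) = record
      { a     = λ i → a i ↑ˡ Y
      ; b     = λ p → X ↑ʳ b p
      ; b-inj = λ p q eq → b-inj p q (Fin.↑ʳ-injective X _ _ eq)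
      ; a-b   = λ i p → across (a i) (b p)
      ; below = below
      }
    blocks⇒grid (inj₂ (a , b , b-inj , below)) = record
      { a     = λ i → X ↑ʳ a i
      ; b     = λ p → b p ↑ˡ Y
      ; b-inj = λ p q eq → b-inj p q (Fin.↑ˡ-injective Y _ _ eq)
      ; a-b   = λ i p → Adj-sym completeBipartite (across (b p) (a i))
      ; below = λ p q i<j → subst₂ _<_ (rank-sym L _ _) (rank-sym L _ _) (below p q i<j)
      }

grid-unavoidable : ∀ t → ∃ λ G → ChromaticNumber G 2 × (∀ L → Grid (2 + t) G L)
grid-unavoidable t with blocks t
... | X , Y , find = K , (completeBipartite-2-colourable X Y , lower) , grid
  where
  K = completeBipartite X Y
  grid : ∀ L → Grid (2 + t) K L
  grid L = blocks⇒grid X Y L (find (weight X Y L) (weight-inj X Y L))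
  lower : ∀ k → Colourable K k → 2 ≤ k
  -- As `X` and `Y` are opaque, an edge of `K` is read off the grid of an arbitrary ordering.
  lower k = edge⇒2≤ K (Grid.a-b (grid (minOrdering K)) f0 f0)

chiPlus-2 : ∀ G → NonEmpty G → NoIsolatedVertices G →
  (∀ L → ∃ λ t → ∀ G′ L′ → Grid (2 + t) G′ L′ → Contains G′ L′ (G ^ L)) →
  ChiPlus G (fin 2)
chiPlus-2 G nonempty noIso embed = chiPlus-fin G 2
  (λ k → edge⇒2≤ G (proj₂ (noIso (fromℕ< nonempty))))
  (λ L → let t , contains = embed L
             G′ , χ , grid = grid-unavoidable t
         in G′ , χ , λ L′ → contains G′ L′ (grid L′))

-- Embedding star forests in grids

bounded : ∀ {N} (h : Fin N → ℕ) → ∃ λ B → ∀ i → h i ≤ B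
bounded {zero}  h = 0 , λ ()
bounded {suc N} h =
  let B , h≤B = bounded (h ∘ fs)
  in h f0 ⊔ B , λ { f0 → ℕ.m≤m⊔n _ _ ; (fs i) → ℕ.≤-trans (h≤B i) (ℕ.m≤n⊔m (h f0) B) }

bounded₂ : ∀ {M N} (h : Fin M → Fin N → ℕ) → ∃ λ B → ∀ i j → h i j ≤ B
bounded₂ h =
  let B , row≤B = bounded (λ i → proj₁ (bounded (h i)))
  in B , λ i j → ℕ.≤-trans (proj₂ (bounded (h i)) j) (row≤B i)

-- The centre `c` lies on `u v`, `u w` and `v z`. If `c` is `u` it misses `v z`, and if it is `v` it
-- misses `u w`.
starForest⇒noNonStarEdge : ∀ G → (∀ v → ComponentIsStar G v) → ¬ NonStarEdge G
starForest⇒noNonStarEdge G star (u , v , w , z , uv , (uw , w≢v) , (vz , z≢u)) with star u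
... | c , _ , edges , _
  with edges u v here (step uv here) uv
     | edges u w here (step uw here) uw
     | edges v z (step uv here) (step uv (step vz here)) vz
... | inj₁ refl | _         | inj₁ v≡u  = Adj⇒≢ G uv (≡-sym v≡u)
... | inj₁ refl | _         | inj₂ z≡u  = z≢u z≡u
... | inj₂ refl | inj₁ u≡v  | _         = Adj⇒≢ G uv u≡v
... | inj₂ refl | inj₂ w≡v  | _         = w≢v w≡v

module StarForest (G : Graph) (noIso : NoIsolatedVertices G)
                  (star : ∀ v → ComponentIsStar G v) where

  nb : Fin (n G) → Fin (n G)
  nb v = proj₁ (noIso v)

  nb-adj : ∀ v → Adj G v (nb v)
  nb-adj v = proj₂ (noIso v)

  Branching : Fin (n G) → Set
  Branching v = ∃ λ w → Adj G v w × w ≢ nb v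

  branching? : ∀ v → Dec (Branching v)
  branching? v = any? λ w → Adj? G v w ×-dec ¬? (w Fin.≟ nb v)

  ¬branching⇒nb : ∀ {v w} → ¬ Branching v → Adj G v w → nb v ≡ w
  ¬branching⇒nb {v} {w} ¬b vw = ≡-sym (decidable-stable (w Fin.≟ nb v) (λ w≢ → ¬b (w , vw , w≢)))

  branching-other : ∀ {v} → Branching v → ∀ y → ∃ λ x → Adj G v x × x ≢ y
  branching-other {v} (w , vw , w≢nb) y with nb v Fin.≟ y
  ... | yes refl = w , vw , w≢nb
  ... | no  nb≢y = nb v , nb-adj v , nb≢y

  branching-not-adjacent : ∀ {u v} → Adj G u v → Branching u → ¬ Branching v
  branching-not-adjacent {u} {v} uv bu bv =
    starForest⇒noNonStarEdge G star
      (u , v , _ , _ , uv , proj₂ (branching-other bu v) , proj₂ (branching-other bv u))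

  -- In a component that is a single edge the endpoint with the smaller index serves as the centre.
  centre : Fin (n G) → Bool
  centre v with branching? v | branching? (nb v) | v Fin.<? nb v
  ... | yes _ | _     | _     = true
  ... | no _  | yes _ | _     = false
  ... | no _  | no _  | yes _ = true
  ... | no _  | no _  | no _  = false

  leaf-unique : ∀ {v w} → centre v ≡ false → Adj G v w → nb v ≡ w
  leaf-unique {v} leaf vw with branching? v
  ... | no ¬b = ¬branching⇒nb ¬b vw

  centre-branching : ∀ {v} → Branching v → centre v ≡ true
  centre-branching {v} b with branching? v
  ... | yes _ = refl
  ... | no ¬b = contradiction b ¬b

  centre-pendant : ∀ {v w} → ¬ Branching v → Adj G v w → Branching w → centre v ≡ false
  -- Replacing `w` by `nb v` lets the case split follow the definition of `centre`.
  centre-pendant {v} ¬b vw bw rewrite ≡-sym (¬branching⇒nb ¬b vw)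
    with branching? v | branching? (nb v)
  ... | yes b | _      = contradiction b ¬b
  ... | no _  | yes _  = refl
  ... | no _  | no ¬bw = contradiction bw ¬bw

  centre-lower : ∀ {v w} → ¬ Branching v → ¬ Branching w → Adj G v w → v Fin.< w → centre v ≡ true
  centre-lower {v} ¬b ¬bw vw v<w rewrite ≡-sym (¬branching⇒nb ¬b vw)
    with branching? v | branching? (nb v) | v Fin.<? nb v
  ... | yes b | _      | _      = contradiction b ¬b
  ... | no _  | yes bw | _      = contradiction bw ¬bw
  ... | no _  | no _   | yes _  = refl
  ... | no _  | no _   | no v≮w = contradiction v<w v≮w

  centre-upper : ∀ {v w} → ¬ Branching v → ¬ Branching w → Adj G v w → w Fin.< v → centre v ≡ false
  centre-upper {v} ¬b ¬bw vw w<v rewrite ≡-sym (¬branching⇒nb ¬b vw)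
    with branching? v | branching? (nb v) | v Fin.<? nb v
  ... | yes b | _      | _       = contradiction b ¬b
  ... | no _  | yes bw | _       = contradiction bw ¬bw
  ... | no _  | no _   | yes v<w = contradiction v<w (ℕ.<⇒≯ w<v)
  ... | no _  | no _   | no _    = refl

  Opposed : Fin (n G) → Fin (n G) → Set
  Opposed u v = centre u ≡ false × centre v ≡ true

  -- Branching vertices are never adjacent, so at most one end branches, and that end is the centre.
  -- If neither does, the edge is a whole component and the comparison of indices decides.
  edge-opposed : ∀ {u v} → Adj G u v → Opposed u v ⊎ Opposed v u
  edge-opposed {u} {v} uv = by-branching (branching? u) (branching? v)
    where
    vu = Adj-sym G uv
    by-branching : Dec (Branching u) → Dec (Branching v) → Opposed u v ⊎ Opposed v u
    by-branching (yes bu) (yes bv) = contradiction bv (branching-not-adjacent uv bu)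
    by-branching (yes bu) (no ¬bv) = inj₂ (centre-pendant ¬bv vu bu , centre-branching bu)
    by-branching (no ¬bu) (yes bv) = inj₁ (centre-pendant ¬bu uv bv , centre-branching bv)
    by-branching (no ¬bu) (no ¬bv) with Fin.<-cmp u v
    ... | tri< u<v _ _ = inj₂ (centre-upper ¬bv ¬bu vu u<v , centre-lower ¬bu ¬bv uv u<v)
    ... | tri≈ _ u≡v _ = contradiction u≡v (Adj⇒≢ G uv)
    ... | tri> _ _ v<u = inj₁ (centre-upper ¬bu ¬bv uv v<u , centre-lower ¬bv ¬bu vu v<u)

  module _ (L : EdgeOrdering G) where

    maxRank : ℕ
    maxRank = proj₁ (bounded₂ (rank L))

    -- Large enough for vertices to serve as indices of `b` and ranks as indices of `a`.
    size : ℕ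
    size = n G + maxRank

    vertex<size : ∀ v → toℕ v < 2 + size
    vertex<size v = ℕ.≤-trans (ℕ.<⇒≤ (s≤s (Fin.toℕ<n v))) (s≤s (ℕ.m≤n⇒m≤1+n (ℕ.m≤m+n (n G) maxRank)))

    rank<size : ∀ u v → rank L u v < 2 + size
    rank<size u v = s≤s (ℕ.m≤n⇒m≤1+n (ℕ.≤-trans (proj₂ (bounded₂ (rank L)) u v) (ℕ.m≤n+m maxRank (n G))))

    module _ {G′ : Graph} {L′ : EdgeOrdering G′} (grid : Grid (2 + size) G′ L′) where
      open Grid grid

      leafIndex : Fin (n G) → Fin (2 + size)
      leafIndex v = fromℕ< (rank<size v (nb v))

      -- A leaf goes to the `a` whose index is the rank of its edge, so `below` reproduces the order
      -- of `L` wherever the centres lie among the `b`.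
      place : Bool → Fin (n G) → Fin (n G′)
      place true  v = b (fromℕ< (vertex<size v))
      place false v = a (leafIndex v)

      embed : Fin (n G) → Fin (n G′)
      embed v = place (centre v) v

      leaves-injective : ∀ {u v} → centre u ≡ false → centre v ≡ false →
                         leafIndex u ≡ leafIndex v → u ≡ v
      leaves-injective {u} {v} leafᵘ leafᵛ eq
        with rank-inj L u (nb u) v (nb v) (nb-adj u) (nb-adj v) (Fin.fromℕ<-injective _ _ _ _ eq)
      ... | inj₁ (u≡v , _) = u≡v
      -- Here the two leaves would be the ends of one edge, but one end of every edge is a centre.
      ... | inj₂ (refl , _) with edge-opposed (nb-adj v)
      ...   | inj₁ (_ , centreᵘ) = contradiction (trans (≡-sym leafᵘ) centreᵘ) (λ ())
      ...   | inj₂ (_ , centreᵛ) = contradiction (trans (≡-sym leafᵛ) centreᵛ) (λ ())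

      embed-injective : ∀ u v → embed u ≡ embed v → u ≡ v
      embed-injective u v eq with centre u in eqᵘ | centre v in eqᵛ
      ... | true  | true  = Fin.toℕ-injective (Fin.fromℕ<-injective _ _ _ _ (b-inj _ _ eq))
      ... | true  | false = contradiction (≡-sym eq) (Adj⇒≢ G′ (a-b _ _))
      ... | false | true  = contradiction eq (Adj⇒≢ G′ (a-b _ _))
      ... | false | false = leaves-injective eqᵘ eqᵛ (a-inj _ _ eq)

      -- Expressing the rank in `L′` through some `a i` and `b p` makes the property independent of
      -- the orientation of `u v`.
      SpokeImage : Fin (n G) → Fin (n G) → Set
      SpokeImage u v = Adj G′ (embed u) (embed v) × ∃ λ i → ∃ λ p →
        rank L u v ≡ toℕ i × rank L′ (embed u) (embed v) ≡ rank L′ (a i) (b p)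

      opposed-image : ∀ {u v} → Adj G u v → Opposed u v → SpokeImage u v
      opposed-image {u} {v} uv (leafᵘ , centreᵛ) rewrite leafᵘ | centreᵛ =
        a-b _ _ , _ , _ ,
        trans (cong (rank L u) (≡-sym (leaf-unique leafᵘ uv))) (≡-sym (Fin.toℕ-fromℕ< _)) , refl

      edge-image : ∀ {u v} → Adj G u v → SpokeImage u v
      edge-image {u} {v} uv with edge-opposed uv
      ... | inj₁ opposed = opposed-image uv opposed
      ... | inj₂ opposed =
        let adj′ , i , p , eq , eq′ = opposed-image (Adj-sym G uv) opposed
        in Adj-sym G′ adj′ , i , p , trans (rank-sym L u v) eq , trans (rank-sym L′ _ _) eq′

      starForest-in-grid : Contains G′ L′ (G ^ L)
      starForest-in-grid = forward⇒Contains {G′} {L′} {G ^ L} embed embed-injective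
        (λ _ _ uv → proj₁ (edge-image uv)) λ u v u′ v′ uv u′v′ lt →
          let _ , _ , p  , eq₁ , eq₁′ = edge-image uv
              _ , _ , p′ , eq₂ , eq₂′ = edge-image u′v′
          in subst₂ _<_ (≡-sym eq₁′) (≡-sym eq₂′) (below p p′ (subst₂ _<_ eq₁ eq₂ lt))

  chiPlus-starForest : NonEmpty G → ChiPlus G (fin 2)
  chiPlus-starForest nonempty = chiPlus-2 G nonempty noIso
    (λ L → size L , λ G′ L′ grid → starForest-in-grid L {G′} {L′} grid)

-- The path and the triangle

data Arrangement : Set where
  ⟨012⟩ ⟨021⟩ ⟨102⟩ ⟨120⟩ ⟨201⟩ ⟨210⟩ : Arrangement

-- Entry `k` is the index meant to carry the `k`-th smallest weight, counted from zero.
arrange : Arrangement → Fin 3 → Fin 3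
arrange ⟨012⟩ = Vec.lookup (f0 ∷ fs f0 ∷ fs (fs f0) ∷ [])
arrange ⟨021⟩ = Vec.lookup (f0 ∷ fs (fs f0) ∷ fs f0 ∷ [])
arrange ⟨102⟩ = Vec.lookup (fs f0 ∷ f0 ∷ fs (fs f0) ∷ [])
arrange ⟨120⟩ = Vec.lookup (fs f0 ∷ fs (fs f0) ∷ f0 ∷ [])
arrange ⟨201⟩ = Vec.lookup (fs (fs f0) ∷ f0 ∷ fs f0 ∷ [])
arrange ⟨210⟩ = Vec.lookup (fs (fs f0) ∷ fs f0 ∷ f0 ∷ [])

arrange-surjective : ∀ π i → ∃ λ k → arrange π k ≡ i
arrange-surjective ⟨012⟩ = from-yes (all? λ i → any? λ k → arrange ⟨012⟩ k Fin.≟ i)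
arrange-surjective ⟨021⟩ = from-yes (all? λ i → any? λ k → arrange ⟨021⟩ k Fin.≟ i)
arrange-surjective ⟨102⟩ = from-yes (all? λ i → any? λ k → arrange ⟨102⟩ k Fin.≟ i)
arrange-surjective ⟨120⟩ = from-yes (all? λ i → any? λ k → arrange ⟨120⟩ k Fin.≟ i)
arrange-surjective ⟨201⟩ = from-yes (all? λ i → any? λ k → arrange ⟨201⟩ k Fin.≟ i)
arrange-surjective ⟨210⟩ = from-yes (all? λ i → any? λ k → arrange ⟨210⟩ k Fin.≟ i)

-- A record, so that `π` and `w` can be inferred from a proof.
record Sorts (π : Arrangement) (w : Fin 3 → ℕ) : Set where
  constructor ascending
  field ascend : ∀ {i j} → i Fin.< j → w (arrange π i) < w (arrange π j)
open Sorts

sorts : ∀ {π w} → w (arrange π f0) < w (arrange π (fs f0)) →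
        w (arrange π (fs f0)) < w (arrange π (fs (fs f0))) → Sorts π w
sorts {π} {w} lt₁ lt₂ = ascending asc
  where
  asc : ∀ {i j} → i Fin.< j → w (arrange π i) < w (arrange π j)
  asc {f0}         {fs f0}      _ = lt₁
  asc {f0}         {fs (fs f0)} _ = ℕ.<-trans lt₁ lt₂
  asc {fs f0}      {fs (fs f0)} _ = lt₂
  asc {fs f0}      {fs f0}      (s≤s ())
  asc {fs (fs f0)} {fs f0}      (s≤s ())
  asc {fs (fs f0)} {fs (fs f0)} (s≤s (s≤s ()))

Sorts⇒injective : ∀ {π w} → Sorts π w → ∀ i j → arrange π i ≡ arrange π j → i ≡ j
Sorts⇒injective {w = w} sorted i j eq with Fin.<-cmp i j
... | tri< i<j _ _ = contradiction (ascend sorted i<j) (ℕ.<-irrefl (cong w eq))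
... | tri≈ _ i≡j _ = i≡j
... | tri> _ _ j<i = contradiction (ascend sorted j<i) (ℕ.<-irrefl (cong w (≡-sym eq)))

Sorts-reflects-< : ∀ {π w} → Sorts π w → ∀ i j → w (arrange π i) < w (arrange π j) → i Fin.< j
Sorts-reflects-< sorted i j lt with Fin.<-cmp i j
... | tri< i<j _ _  = i<j
... | tri≈ _ refl _ = contradiction lt (ℕ.<-irrefl refl)
... | tri> _ _ j<i  = contradiction (ascend sorted j<i) (ℕ.<⇒≯ lt)

sort : ∀ (w : Fin 3 → ℕ) → (∀ i j → w i ≡ w j → i ≡ j) → ∃ λ π → Sorts π w
sort w w-inj with ℕ.<-cmp (w f0) (w (fs f0)) | ℕ.<-cmp (w f0) (w (fs (fs f0))) | ℕ.<-cmp (w (fs f0)) (w (fs (fs f0)))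
... | tri≈ _ eq _ | _ | _ = contradiction (w-inj _ _ eq) λ ()
... | _ | tri≈ _ eq _ | _ = contradiction (w-inj _ _ eq) λ ()
... | _ | _ | tri≈ _ eq _ = contradiction (w-inj _ _ eq) λ ()
-- Two comparisons suffice in each clause. The two cyclic combinations, which no weights realise,
-- fall under the first two of these six clauses.
... | tri< 0<1 _ _ | _ | tri< 1<2 _ _ = ⟨012⟩ , sorts 0<1 1<2
... | _ | tri< 0<2 _ _ | tri> _ _ 2<1 = ⟨021⟩ , sorts 0<2 2<1
... | tri> _ _ 1<0 | tri< 0<2 _ _ | _ = ⟨102⟩ , sorts 1<0 0<2
... | _ | tri> _ _ 2<0 | tri< 1<2 _ _ = ⟨120⟩ , sorts 1<2 2<0
... | tri< 0<1 _ _ | tri> _ _ 2<0 | _ = ⟨201⟩ , sorts 2<0 0<1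
... | tri> _ _ 1<0 | _ | tri> _ _ 2<1 = ⟨210⟩ , sorts 2<1 1<0

sorted-transfer : ∀ {π w w′} → Sorts π w → Sorts π w′ → ∀ i j → w i < w j → w′ i < w′ j
sorted-transfer {π} sorted sorted′ i j lt with arrange-surjective π i | arrange-surjective π j
... | k , refl | l , refl = ascend sorted′ (Sorts-reflects-< sorted k l lt)

-- Edge `e` of the path joins `inject₁ e` to `fs e`; facts about this indexing are finite and are
-- decided by evaluation.
P4-edge : ∀ i j → Adj P4 i j → ∃ λ e → SameEdge i j (inject₁ e) (fs e)
P4-edge = from-yes (all? λ i → all? λ j → Adj? P4 i j →-dec any? λ e → SameEdge? i j (inject₁ e) (fs e))

P4-edge-adj : ∀ e → Adj P4 (inject₁ e) (fs e)
P4-edge-adj = from-yes (all? λ e → Adj? P4 (inject₁ e) (fs e))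

P4-edge-injective : ∀ (e e′ : Fin 3) → SameEdge (inject₁ e) (fs e) (inject₁ e′) (fs e′) → e ≡ e′
P4-edge-injective = from-yes (all? {3} λ e → all? λ e′ →
  SameEdge? (inject₁ e) (fs e) (inject₁ e′) (fs e′) →-dec e Fin.≟ e′)

SameEdge-rank : ∀ {G} (L : EdgeOrdering G) {i j k l} → SameEdge i j k l → rank L i j ≡ rank L k l
SameEdge-rank L (inj₁ (refl , refl)) = refl
SameEdge-rank L (inj₂ (refl , refl)) = rank-sym L _ _

SameEdge-Adj : ∀ G {i j k l} → SameEdge i j k l → Adj G k l → Adj G i j
SameEdge-Adj G (inj₁ (refl , refl)) kl = kl
SameEdge-Adj G (inj₂ (refl , refl)) kl = Adj-sym G kl

SameEdge-map : ∀ {M N} (f : Fin M → Fin N) {i j k l} → SameEdge i j k l → SameEdge (f i) (f j) (f k) (f l)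
SameEdge-map f (inj₁ (i≡k , j≡l)) = inj₁ (cong f i≡k , cong f j≡l)
SameEdge-map f (inj₂ (i≡l , j≡k)) = inj₂ (cong f i≡l , cong f j≡k)

module _ {G H : Graph} (iso : Iso G H) where
  open Iso iso

  to-injective : ∀ x y → to x ≡ to y → x ≡ y
  to-injective x y eq = trans (≡-sym (from-to x)) (trans (cong from eq) (from-to y))

  from-injective : ∀ i j → from i ≡ from j → i ≡ j
  from-injective i j eq = trans (≡-sym (to-from i)) (trans (cong to eq) (to-from j))

  to-adj : ∀ {x y} → Adj G x y → Adj H (to x) (to y)
  to-adj xy = trans (adj-pres _ _) xy

  from-adj : ∀ {i j} → Adj H i j → Adj G (from i) (from j)
  from-adj ij = trans (≡-sym (adj-pres _ _)) (trans (cong₂ (adj H) (to-from _) (to-from _)) ij)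

  transport : EdgeOrdering G → EdgeOrdering H
  transport L = record
    { rank     = λ i j → rank L (from i) (from j)
    ; rank-sym = λ i j → rank-sym L (from i) (from j)
    ; rank-inj = λ i j k l ij kl eq → reflect (rank-inj L _ _ _ _ (from-adj ij) (from-adj kl) eq)
    }
    where
    reflect : ∀ {i j k l} → SameEdge (from i) (from j) (from k) (from l) → SameEdge i j k l
    reflect (inj₁ (i≡k , j≡l)) = inj₁ (from-injective _ _ i≡k , from-injective _ _ j≡l)
    reflect (inj₂ (i≡l , j≡k)) = inj₂ (from-injective _ _ i≡l , from-injective _ _ j≡k)

  transport-rank : ∀ L x y → rank (transport L) (to x) (to y) ≡ rank L x y
  transport-rank L x y = cong₂ (rank L) (from-to x) (from-to y)

  Contains-transport : ∀ {G′ L′ L} → Contains G′ L′ (H ^ transport L) →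
                       Contains G′ L′ (G ^ L)
  Contains-transport {G′} {L′} {L} (f , f-inj , f-adj , f-ord) = forward⇒Contains {G′} {L′} {G ^ L} (f ∘ to)
    (λ x y eq → to-injective x y (f-inj _ _ eq)) (λ x y xy → f-adj _ _ (to-adj xy))
    λ x y x′ y′ xy x′y′ lt → proj₁ (f-ord _ _ _ _ (to-adj xy) (to-adj x′y′))
      (subst₂ _<_ (≡-sym (transport-rank L x y)) (≡-sym (transport-rank L x′ y′)) lt)

module _ (L : EdgeOrdering P4) where

  pathWeight : Fin 3 → ℕ
  pathWeight e = rank L (inject₁ e) (fs e)

  pathWeight-injective : ∀ e e′ → pathWeight e ≡ pathWeight e′ → e ≡ e′
  pathWeight-injective e e′ eq =
    P4-edge-injective e e′ (rank-inj L _ _ _ _ (P4-edge-adj e) (P4-edge-adj e′) eq)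

  module _ {G′ : Graph} {L′ : EdgeOrdering G′} where

    path : (c d c′ d′ : Fin (n G′)) → Fin 4 → Fin (n G′)
    path c d c′ d′ = Vec.lookup (c ∷ d ∷ c′ ∷ d′ ∷ [])

    -- The image ranks form a separate vector `w′`, so that each edge can be written from `a` to
    -- `b`, the orientation used by `below`.
    path-Contains : ∀ π → Sorts π pathWeight → ∀ {c d c′ d′} → c ≢ c′ → d ≢ d′ →
      Adj G′ c d → Adj G′ d c′ → Adj G′ c′ d′ → c ≢ d′ →
      (w′ : Vec ℕ 3) → (∀ e → rank L′ (path c d c′ d′ (inject₁ e)) (path c d c′ d′ (fs e)) ≡ Vec.lookup w′ e) →
      Sorts π (Vec.lookup w′) →
      Contains G′ L′ (P4 ^ L)
    path-Contains π sorted {c} {d} {c′} {d′} c≢c′ d≢d′ cd dc′ c′d′ c≢d′ w′ weights sorted′ =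
      forward⇒Contains {G′} {L′} {P4 ^ L} g g-inj
        (λ i j ij → let e , same = P4-edge i j ij in SameEdge-Adj G′ (SameEdge-map g same) (g-edge e))
        λ i j k l ij kl lt →
          let e  , same  = P4-edge i j ij
              e′ , same′ = P4-edge k l kl
          in subst₂ _<_ (≡-sym (trans (SameEdge-rank L′ (SameEdge-map g same)) (weights e)))
                        (≡-sym (trans (SameEdge-rank L′ (SameEdge-map g same′)) (weights e′)))
               (sorted-transfer sorted sorted′ e e′
                 (subst₂ _<_ (SameEdge-rank L same) (SameEdge-rank L same′) lt))
      where
      g = path c d c′ d′
      g-edge : ∀ e → Adj G′ (g (inject₁ e)) (g (fs e))
      g-edge f0           = cd
      g-edge (fs f0)      = dc′
      g-edge (fs (fs f0)) = c′d′
      g-inj : ∀ i j → g i ≡ g j → i ≡ j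
      g-inj f0                f0                _  = refl
      g-inj f0                (fs f0)           eq = contradiction eq (Adj⇒≢ G′ cd)
      g-inj f0                (fs (fs f0))      eq = contradiction eq c≢c′
      g-inj f0                (fs (fs (fs f0))) eq = contradiction eq c≢d′
      g-inj (fs f0)           f0                eq = contradiction (≡-sym eq) (Adj⇒≢ G′ cd)
      g-inj (fs f0)           (fs f0)           _  = refl
      g-inj (fs f0)           (fs (fs f0))      eq = contradiction eq (Adj⇒≢ G′ dc′)
      g-inj (fs f0)           (fs (fs (fs f0))) eq = contradiction eq d≢d′
      g-inj (fs (fs f0))      f0                eq = contradiction (≡-sym eq) c≢c′
      g-inj (fs (fs f0))      (fs f0)           eq = contradiction (≡-sym eq) (Adj⇒≢ G′ dc′)
      g-inj (fs (fs f0))      (fs (fs f0))      _  = refl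
      g-inj (fs (fs f0))      (fs (fs (fs f0))) eq = contradiction eq (Adj⇒≢ G′ c′d′)
      g-inj (fs (fs (fs f0))) f0                eq = contradiction (≡-sym eq) c≢d′
      g-inj (fs (fs (fs f0))) (fs f0)           eq = contradiction (≡-sym eq) d≢d′
      g-inj (fs (fs (fs f0))) (fs (fs f0))      eq = contradiction (≡-sym eq) (Adj⇒≢ G′ c′d′)
      g-inj (fs (fs (fs f0))) (fs (fs (fs f0))) _  = refl

    module _ (grid : Grid 2 G′ L′) where
      open Grid grid

      b-a : ∀ p i → Adj G′ (b p) (a i)
      b-a p i = Adj-sym G′ (a-b i p)

      -- `below` says nothing about two edges at the same `a i`, so the two `b` are named after
      -- their order there.
      ordered-pair : ∀ i → ∃ λ p → ∃ λ q → b p ≢ b q × rank L′ (a i) (b p) < rank L′ (a i) (b q)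
      ordered-pair i with ℕ.<-cmp (rank L′ (a i) (b f0)) (rank L′ (a i) (b (fs f0)))
      ... | tri< lt _ _ = f0 , fs f0 , (λ eq → contradiction (b-inj _ _ eq) λ ()) , lt
      ... | tri> _ _ gt = fs f0 , f0 , (λ eq → contradiction (b-inj _ _ eq) λ ()) , gt
      ... | tri≈ _ eq _ with rank-inj L′ _ _ _ _ (a-b i f0) (a-b i (fs f0)) eq
      ...   | inj₁ (_ , b≡b)  = contradiction (b-inj _ _ b≡b) λ ()
      ...   | inj₂ (a≡b , _)  = contradiction a≡b (Adj⇒≢ G′ (a-b i (fs f0)))

      a≢a : a f0 ≢ a (fs f0)
      a≢a eq = contradiction (a-inj _ _ eq) λ ()

      low : ∀ p q → rank L′ (a f0) (b p) < rank L′ (a (fs f0)) (b q)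
      low p q = below p q (s≤s z≤n)

      m : Fin 2 → Fin 2 → ℕ
      m i p = rank L′ (a i) (b p)

      -- In this path the first two edges lie at `a i` and the last at `a j`; in `abab` the first
      -- lies at `a i` and the last two at `a j`.
      baba : ∀ π → Sorts π pathWeight → ∀ p i q j → b p ≢ b q → a i ≢ a j →
        Sorts π (Vec.lookup (m i p ∷ m i q ∷ m j q ∷ [])) →
        Contains G′ L′ (P4 ^ L)
      baba π sorted p i q j bp≢bq ai≢aj = path-Contains π sorted bp≢bq ai≢aj
        (b-a p i) (a-b i q) (b-a q j) (Adj⇒≢ G′ (b-a p j)) (m i p ∷ m i q ∷ m j q ∷ [])
        λ { f0 → rank-sym L′ _ _ ; (fs f0) → refl ; (fs (fs f0)) → rank-sym L′ _ _ }

      abab : ∀ π → Sorts π pathWeight → ∀ i p j q → a i ≢ a j → b p ≢ b q →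
        Sorts π (Vec.lookup (m i p ∷ m j p ∷ m j q ∷ [])) →
        Contains G′ L′ (P4 ^ L)
      abab π sorted i p j q ai≢aj bp≢bq = path-Contains π sorted ai≢aj bp≢bq
        (a-b i p) (b-a p j) (a-b j q) (Adj⇒≢ G′ (a-b i q)) (m i p ∷ m j p ∷ m j q ∷ [])
        λ { f0 → refl ; (fs f0) → rank-sym L′ _ _ ; (fs (fs f0)) → refl }

      P4-in-grid : Contains G′ L′ (P4 ^ L)
      P4-in-grid =
        let π , sorted        = sort pathWeight pathWeight-injective
            p  , q  , p≢q  , lt  = ordered-pair f0
            p′ , q′ , p′≢q′ , lt′ = ordered-pair (fs f0)
        in by-arrangement π sorted p q p≢q lt p′ q′ p′≢q′ lt′
        where
        -- The middle edge cannot be both smallest and largest, so some end edge is extreme. It is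
        -- placed alone at one `a` while the other two edges share the other: `baba` if the last
        -- edge is extreme, `abab` if only the first is.
        by-arrangement : ∀ π → Sorts π pathWeight →
          ∀ p q → b p ≢ b q → m f0 p < m f0 q →
          ∀ p′ q′ → b p′ ≢ b q′ → m (fs f0) p′ < m (fs f0) q′ →
          Contains G′ L′ (P4 ^ L)
        by-arrangement ⟨012⟩ s p q p≢q lt p′ q′ p′≢q′ lt′ =
          baba ⟨012⟩ s p f0 q (fs f0) p≢q a≢a (sorts lt (low q q))
        by-arrangement ⟨102⟩ s p q p≢q lt p′ q′ p′≢q′ lt′ =
          baba ⟨102⟩ s q f0 p (fs f0) (p≢q ∘ ≡-sym) a≢a (sorts lt (low q p))
        by-arrangement ⟨201⟩ s p q p≢q lt p′ q′ p′≢q′ lt′ =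
          baba ⟨201⟩ s p′ (fs f0) q′ f0 p′≢q′ (a≢a ∘ ≡-sym) (sorts (low q′ p′) lt′)
        by-arrangement ⟨210⟩ s p q p≢q lt p′ q′ p′≢q′ lt′ =
          baba ⟨210⟩ s q′ (fs f0) p′ f0 (p′≢q′ ∘ ≡-sym) (a≢a ∘ ≡-sym) (sorts (low p′ p′) lt′)
        by-arrangement ⟨021⟩ s p q p≢q lt p′ q′ p′≢q′ lt′ =
          abab ⟨021⟩ s f0 q′ (fs f0) p′ a≢a (p′≢q′ ∘ ≡-sym) (sorts (low q′ p′) lt′)
        by-arrangement ⟨120⟩ s p q p≢q lt p′ q′ p′≢q′ lt′ =
          abab ⟨120⟩ s (fs f0) p f0 q (a≢a ∘ ≡-sym) p≢q (sorts lt (low q p))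

chiPlus-P4 : ∀ G → NonEmpty G → NoIsolatedVertices G → Iso G P4 → ChiPlus G (fin 2)
chiPlus-P4 G nonempty noIso iso = chiPlus-2 G nonempty noIso λ L →
  0 , λ G′ L′ grid → Contains-transport iso {G′} {L′} {L} (P4-in-grid (transport iso L) grid)

-- The triangle

next : Fin 3 → Fin 3
next f0           = fs f0
next (fs f0)      = fs (fs f0)
next (fs (fs f0)) = f0

K3-edge : ∀ i j → Adj K3 i j → ∃ λ e → SameEdge i j (next e) (next (next e))
K3-edge = from-yes (all? λ i → all? λ j → Adj? K3 i j →-dec
            any? λ e → SameEdge? i j (next e) (next (next e)))

K3-edge-adj : ∀ e → Adj K3 (next e) (next (next e))
K3-edge-adj = from-yes (all? λ e → Adj? K3 (next e) (next (next e)))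

K3-edge-injective : ∀ e e′ → SameEdge (next e) (next (next e)) (next e′) (next (next e′)) → e ≡ e′
K3-edge-injective = from-yes (all? λ e → all? λ e′ →
  SameEdge? (next e) (next (next e)) (next e′) (next (next e′)) →-dec e Fin.≟ e′)

K3-third : ∀ i j k → i ≢ j → i ≢ k → j ≢ k → SameEdge i j (next k) (next (next k))
K3-third = from-yes (all? λ i → all? λ j → all? λ k →
  ¬? (i Fin.≟ j) →-dec ¬? (i Fin.≟ k) →-dec ¬? (j Fin.≟ k) →-dec SameEdge? i j (next k) (next (next k)))

-- The edges of K3 are indexed by their opposite vertices, so that a permutation of the vertices
-- permutes the edges in the same way.
oppositeWeight : EdgeOrdering K3 → Fin 3 → ℕ
oppositeWeight L e = rank L (next e) (next (next e))

oppositeWeight-injective : ∀ L e e′ → oppositeWeight L e ≡ oppositeWeight L e′ → e ≡ e′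
oppositeWeight-injective L e e′ eq =
  K3-edge-injective e e′ (rank-inj L _ _ _ _ (K3-edge-adj e) (K3-edge-adj e′) eq)

next-≢ : ∀ e → e ≢ next e × next e ≢ next (next e) × next (next e) ≢ e
next-≢ = from-yes (all? λ e →
  ¬? (e Fin.≟ next e) ×-dec (¬? (next e Fin.≟ next (next e)) ×-dec ¬? (next (next e) Fin.≟ e)))

-- All orderings of a triangle are isomorphic: `σ` sends the vertex opposite the `k`-th edge of `L`
-- to the vertex opposite the `k`-th edge of `L′`.
K3-in-K3 : ∀ L L′ → Contains K3 L′ (K3 ^ L)
K3-in-K3 L L′ = forward⇒Contains {K3} {L′} {K3 ^ L} σ σ-inj
  (λ i j ij → ≢⇒K3-adj _ _ (λ eq → Adj⇒≢ K3 {i} {j} ij (σ-inj i j eq)))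
  λ i j k l ij kl lt →
    let e  , same  = K3-edge i j ij
        e′ , same′ = K3-edge k l kl
    in subst₂ _<_ (≡-sym (image same)) (≡-sym (image same′))
         (sorted-transfer sorted sorted″ e e′ (subst₂ _<_ (SameEdge-rank L same) (SameEdge-rank L same′) lt))
  where
  sorting = sort (oppositeWeight L) (oppositeWeight-injective L)
  π = proj₁ sorting
  sorted : Sorts π (oppositeWeight L)
  sorted = proj₂ sorting
  sorting′ = sort (oppositeWeight L′) (oppositeWeight-injective L′)
  ρ = proj₁ sorting′
  sorted′ : Sorts ρ (oppositeWeight L′)
  sorted′ = proj₂ sorting′
  position : Fin 3 → Fin 3
  position i = proj₁ (arrange-surjective π i)
  arrange-position : ∀ i → arrange π (position i) ≡ i
  arrange-position i = proj₂ (arrange-surjective π i)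
  position-arrange : ∀ i → position (arrange π i) ≡ i
  position-arrange i = Sorts⇒injective sorted _ _ (arrange-position (arrange π i))
  σ : Fin 3 → Fin 3
  σ = arrange ρ ∘ position
  σ-inj : ∀ i j → σ i ≡ σ j → i ≡ j
  σ-inj i j eq = trans (≡-sym (arrange-position i)) (trans (cong (arrange π)
    (Sorts⇒injective sorted′ _ _ eq)) (arrange-position j))
  sorted″ : Sorts π (oppositeWeight L′ ∘ σ)
  sorted″ = ascending λ {i} {j} i<j →
    subst₂ (λ k l → oppositeWeight L′ (arrange ρ k) < oppositeWeight L′ (arrange ρ l))
      (≡-sym (position-arrange i)) (≡-sym (position-arrange j)) (ascend sorted′ i<j)
  image : ∀ {i j e} → SameEdge i j (next e) (next (next e)) →
          rank L′ (σ i) (σ j) ≡ oppositeWeight L′ (σ e)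
  image {e = e} same = trans (SameEdge-rank L′ (SameEdge-map σ same)) (SameEdge-rank L′
    -- The images of the three vertices are distinct, so the image of the edge opposite `e` is the
    -- edge opposite `σ e`.
    (let e≢ , next≢ , ≢e = next-≢ e
     in K3-third _ _ _ (next≢ ∘ σ-inj _ _) (e≢ ∘ ≡-sym ∘ σ-inj _ _) (≢e ∘ σ-inj _ _)))

-- `K3` serves as its own unavoidable host, and as a clique it needs three colours.
chiPlus-K3 : ∀ G → Iso G K3 → ChiPlus G (fin 3)
chiPlus-K3 G iso = chiPlus-fin G 3
  (λ k → clique⇒≤ G (Iso.from iso) (λ i j i≢j → from-adj iso (≢⇒K3-adj i j i≢j)))
  (λ L → K3 , ((id , λ u v → Adj⇒≢ K3) , λ k → clique⇒≤ K3 id ≢⇒K3-adj) ,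
         λ L′ → Contains-transport iso {K3} {L′} {L} (K3-in-K3 (transport iso L) L′))

theorem2p18 : (G : Graph) → NonEmpty G → NoIsolatedVertices G →
    ((IsStarForest G ⊎ Iso G P4) → ChiPlus G (fin 2))
    × (Iso G K3 → ChiPlus G (fin 3))
    × (¬ IsStarForest G → ¬ Iso G P4 → ¬ Iso G K3 → ChiPlus G ∞)
theorem2p18 G nonempty noIso =
  (λ { (inj₁ (_ , star)) → StarForest.chiPlus-starForest G noIso star nonempty
     ; (inj₂ iso)        → chiPlus-P4 G nonempty noIso iso }) ,
  chiPlus-K3 G ,
  chiPlus-∞ G noIso nonempty
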